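{- In the setting described in the context, $\rho(G(a,b))=\max\{1,\tfrac{3}{d}\}$.
   Context: Let $p\geq5$ be a prime and $G\leq\mathrm{Sym}(\Omega)$ transitive with $|\Omega|=3p$, whose only non-trivial $G$-invariant partition is $\mathcal{B}=\{B_1,\dots,B_p\}$ with $|B_i|=3$. Let $\overline{G}\leq\mathrm{Sym}(\mathcal{B})$ be the induced group and $K=\ker(G\to\overline{G})$. Assume $K\neq1$, $K$ contains no derangement (every element of $K$ fixes a point), every minimal normal subgroup of $G$ contained in $K$ is an elementary abelian $3$-group, and $K$ contains an involution. Assume $\overline{G}$ is solvable: $\overline{G}=\langle\alpha\rangle\rtimes\langle\beta\rangle\leq\mathrm{AGL}(1,p)$ with $\alpha$ a $p$-cycle, $o(\beta)=d\mid p-1$, $\beta$ fixing $B_1$, $\beta\alpha\beta^{ -1}=\alpha^t$ with $\gcd(t,p)=1$. Let $a\in G$ be a semiregular element of order $p$ (a product of three $p$-cycles) with image $\alpha$ and $b\in G$ with image $\beta$. Let $G(a,b)=\langle K,a,b\rangle$. For a transitive group $H\leq\mathrm{Sym}(\Omega)$, $\rho(H)=\max\{|\mathcal{F}|:\mathcal{F}\subseteq H\text{ intersecting}\}/|H_\omega|$, where $\mathcal{F}$ is intersecting if any two of its elements agree on some point of $\Omega$. -}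

module Defs where

open import Level using (Level; 0ℓ)
open import Data.Nat using (ℕ; zero; suc; _<_; _*_)
open import Data.Fin using (Fin)
open import Data.Fin.Permutation as P using (Permutation′; _⟨$⟩ʳ_; _∘ₚ_; flip)
open import Data.Product using (Σ; ∃; _×_; _,_)
open import Data.Sum using (_⊎_)
open import Data.List using (List)
open import Data.List.Relation.Unary.All using (All)
open import Data.List.Relation.Unary.Any using (Any)
open import Data.List.Relation.Unary.AllPairs using (AllPairs)
open import Relation.Nullary using (¬_)
open import Relation.Binary using (IsEquivalence)
open import Relation.Binary.PropositionalEquality using (_≡_; _≢_)
open import Function.Bundles using (_⇔_)

Perm : ℕ → Set
Perm n = Permutation′ n

module _ {n : ℕ} where

  app : Perm n → Fin n → Fin n
  app g x = g ⟨$⟩ʳ x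

  _≈_ : Perm n → Perm n → Set
  g ≈ h = ∀ x → app g x ≡ app h x

  -- composition: (g · h) x = g (h x)
  _·_ : Perm n → Perm n → Perm n
  g · h = h ∘ₚ g

  e : Perm n
  e = P.id

  _⁻¹ : Perm n → Perm n
  g ⁻¹ = flip g

  pow : Perm n → ℕ → Perm n
  pow g zero = e
  pow g (suc k) = g · pow g k

  record IsSubgroup (H : Perm n → Set) : Set where
    field
      resp  : ∀ {g h} → g ≈ h → H g → H h
      has-e : H e
      mul   : ∀ {g h} → H g → H h → H (g · h)
      inv   : ∀ {g} → H g → H (g ⁻¹)

  data Gen (S : Perm n → Set) : Perm n → Set where
    gen  : ∀ {g} → S g → Gen S g
    one  : Gen S e
    mul  : ∀ {g h} → Gen S g → Gen S h → Gen S (g · h)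
    inv  : ∀ {g} → Gen S g → Gen S (g ⁻¹)
    resp : ∀ {g h} → g ≈ h → Gen S g → Gen S h

  Transitive : (Perm n → Set) → Set
  Transitive H = ∀ x y → ∃ λ g → H g × app g x ≡ y

  InvariantPartition : (Perm n → Set) → (Fin n → Fin n → Set) → Set
  InvariantPartition H R =
    IsEquivalence R × (∀ g → H g → ∀ x y → R x y → R (app g x) (app g y))

  TrivialPartition : (Fin n → Fin n → Set) → Set
  TrivialPartition R = (∀ x y → R x y) ⊎ (∀ x y → R x y → x ≡ y)

  Nontrivial : (Perm n → Set) → Set
  Nontrivial N = ∃ λ g → N g × ¬ (g ≈ e)

  Normal : (Perm n → Set) → (Perm n → Set) → Set
  Normal G N = IsSubgroup N × (∀ g → N g → G g)
             × (∀ g h → G g → N h → N ((g · h) · (g ⁻¹)))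

  MinimalNormal : (Perm n → Set) → (Perm n → Set) → Set₁
  MinimalNormal G N = Normal G N × Nontrivial N
    × (∀ (M : Perm n → Set) → Normal G M → (∀ g → M g → N g)
         → (¬ Nontrivial M) ⊎ (∀ g → N g → M g))

  -- (N is assumed nontrivial where this is used) elementary abelian 3-group
  ElementaryAbelian3 : (Perm n → Set) → Set
  ElementaryAbelian3 N = (∀ g h → N g → N h → (g · h) ≈ (h · g))
                       × (∀ g → N g → pow g 3 ≈ e)

  IntersectingFamily : (Perm n → Set) → List (Perm n) → Set
  IntersectingFamily H F = All H F × AllPairs (λ g h → ¬ (g ≈ h)) F
                         × AllPairs (λ g h → ∃ λ x → app g x ≡ app h x) F

  EnumeratesStabiliser : (Perm n → Set) → Fin n → List (Perm n) → Set
  EnumeratesStabiliser H ω L =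
    All (λ g → H g × app g ω ≡ ω) L × AllPairs (λ g h → ¬ (g ≈ h)) L
    × (∀ g → H g → app g ω ≡ ω → Any (λ h → g ≈ h) L)

module _ {p : ℕ} (blk : Fin (3 * p) → Fin p) where
  -- blk x = index of the block of B containing x

  BlocksOfSize3 : Set
  BlocksOfSize3 = ∀ i → Σ (Fin (3 * p)) λ x → Σ (Fin (3 * p)) λ y → Σ (Fin (3 * p)) λ z →
    (blk x ≡ i × blk y ≡ i × blk z ≡ i × x ≢ y × x ≢ z × y ≢ z)
    × (∀ w → blk w ≡ i → (w ≡ x ⊎ w ≡ y ⊎ w ≡ z))

  UniqueNontrivialBlockSystem : (Perm (3 * p) → Set) → Set₁
  UniqueNontrivialBlockSystem G =
    (∀ g → G g → ∀ x y → blk x ≡ blk y → blk (app g x) ≡ blk (app g y))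
    × (∀ (R : Fin (3 * p) → Fin (3 * p) → Set) → InvariantPartition G R
         → TrivialPartition R ⊎ (∀ x y → R x y ⇔ (blk x ≡ blk y)))

  Kernel : (Perm (3 * p) → Set) → Perm (3 * p) → Set
  Kernel G g = G g × (∀ x → blk (app g x) ≡ blk x)

  SameOnBlocks : Perm (3 * p) → Perm (3 * p) → Set
  SameOnBlocks g h = ∀ x → blk (app g x) ≡ blk (app h x)

  FixesBlock : Perm (3 * p) → Fin p → Set
  FixesBlock g i = ∀ x → blk x ≡ i → blk (app g x) ≡ i

-- The subgroups involved are compared through the orientation of the blocks. Fix a 3-cycle r on
-- every block commuting with a; each g ∈ G preserves or reverses r on each block. If some element
-- of K had mixed behaviour, conjugation would separate the blocks, commutators would give elements
-- of K supported on one block only, and a product of these would be a derangement. So every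
-- element of K has a constant sign, and as p is odd so does every element of G.
--
-- Let C be the even part of K: it has index 2 because of the involution, an element of it with a
-- fixed point fixes that point's whole block, and it is transitive on each block. With n = |C_ω|
-- this gives |C| = 3n, |K| = 6n, and |G_ω| = 2dn by counting the stabiliser of a block twice.
--
-- Let X be the elements of one sign in an intersecting family. If X lies in one coset of K, then
-- |X| ≤ |C| = 3n. Otherwise split X into d parts by the exponent of b. A non-trivial element of
-- the Frobenius group G/K fixes at most one block, so all elements of a part agree on one whole
-- block and the part has at most n elements; thus |X| ≤ dn. Both signs together give
-- 2n max(3, d), which is attained by K if d ≤ 3 and by G_ω if d ≥ 3.
module Submission where

open import Defs
open import Data.Nat as ℕ using (ℕ; zero; suc; _<_; _≤_; _+_; _*_; _∸_; _⊔_; s≤s; z≤n; NonZero; ∣_-_∣)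
import Data.Nat.Properties as ℕ
open import Data.Nat.Solver using (module +-*-Solver)
open +-*-Solver using (solve; _:+_; _:*_; _:=_; con)
open import Data.Empty using (⊥)
open import Data.Nat.DivMod using (_/_; _%_; m≡m%n+[m/n]*n; m%n<n)
open import Data.Nat.Divisibility using (_∣_; divides; m%n≡0⇒n∣m; >⇒∤)
open import Data.Nat.GCD using (gcd)
open import Data.Nat.Primality using (Prime; prime⇒nonZero; prime⇒irreducible; euclidsLemma)
open import Data.Fin using (Fin; zero; suc; toℕ; fromℕ<; combine; remQuot; punchOut; splitAt; _↑ˡ_; _↑ʳ_)
import Data.Fin.Properties as Fin
open import Data.Fin.Permutation using (inverseˡ; inverseʳ)
open import Data.Bool using (Bool; true; false; not; _xor_)
open import Data.Bool.Properties using (xor-same; xor-identityʳ)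
open import Data.List using (List; []; _∷_; length; lookup; filter; tabulate)
open import Data.List.Properties using (length-tabulate)
open import Data.List.Membership.Propositional using (_∈_)
open import Data.List.Membership.Propositional.Properties using (∈-lookup; ∈-AllPairs₂)
open import Data.List.Relation.Unary.All as All using (All; []; _∷_)
import Data.List.Relation.Unary.All.Properties as All
open import Data.List.Relation.Unary.Any as Any using (Any)
import Data.List.Relation.Unary.Any.Properties as Any
open import Data.List.Relation.Unary.AllPairs as AllPairs using (AllPairs; []; _∷_)
import Data.List.Relation.Unary.AllPairs.Properties as AllPairs
open import Data.Product using (Σ; ∃; _×_; _,_; proj₁; proj₂)
open import Data.Sum using (_⊎_; inj₁; inj₂; [_,_]′)
open import Function using (_∘_)
open import Function.Bundles using (Equivalence)
open import Relation.Nullary using (¬_; Dec; yes; no; contradiction)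
open import Relation.Binary using (tri<; tri≈; tri>)
open import Relation.Binary.PropositionalEquality
  using (_≡_; _≢_; refl; sym; trans; cong; subst; subst₂; module ≡-Reasoning)

-- Counting finite sets of permutations

injective⇒surjective : ∀ {n} (f : Fin n → Fin n) → (∀ {i j} → f i ≡ f j → i ≡ j) →
                       ∀ y → ∃ λ i → f i ≡ y
injective⇒surjective {suc n} f inj y with Fin.any? (λ i → f i Fin.≟ y)
... | yes i  = i
-- Removing a missed value from the codomain would inject `Fin (suc n)` into `Fin n`.
... | no ¬hit = contradiction
      (Fin.injective⇒≤ {f = λ i → punchOut (λ y≡fi → ¬hit (i , sym y≡fi))}
        (λ {i} {j} eq → inj (Fin.punchOut-injective
          (λ y≡fi → ¬hit (i , sym y≡fi)) (λ y≡fj → ¬hit (j , sym y≡fj)) eq)))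
      ℕ.1+n≰n

lookup-pairs : ∀ {A : Set} {R : A → A → Set} → (∀ {x y} → R x y → R y x) →
               ∀ {xs} → AllPairs R xs → ∀ i j → i ≢ j → R (lookup xs i) (lookup xs j)
lookup-pairs sy (_ ∷ _)   zero    zero    i≢j = contradiction refl i≢j
lookup-pairs sy (rs ∷ _)  zero    (suc j) _   = All.lookup rs (∈-lookup j)
lookup-pairs sy (rs ∷ _)  (suc i) zero    _   = sy (All.lookup rs (∈-lookup i))
lookup-pairs sy (_ ∷ prs) (suc i) (suc j) i≢j = lookup-pairs sy prs i j (i≢j ∘ cong suc)

module _ {n : ℕ} where

  ⁻¹-cancelˡ : ∀ (g : Perm n) x → app (g ⁻¹) (app g x) ≡ x
  ⁻¹-cancelˡ g x = inverseˡ g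

  ⁻¹-cancelʳ : ∀ (g : Perm n) x → app g (app (g ⁻¹) x) ≡ x
  ⁻¹-cancelʳ g x = inverseʳ g

  app-injective : ∀ (g : Perm n) {x y} → app g x ≡ app g y → x ≡ y
  app-injective g {x} {y} eq =
    trans (sym (⁻¹-cancelˡ g x)) (trans (cong (app (g ⁻¹)) eq) (⁻¹-cancelˡ g y))

  pow-+ : ∀ (g : Perm n) i j x → app (pow g (i + j)) x ≡ app (pow g i) (app (pow g j) x)
  pow-+ g zero    j x = refl
  pow-+ g (suc i) j x = cong (app g) (pow-+ g i j x)

  pow-closed : ∀ {G : Perm n → Set} → IsSubgroup G → ∀ {g} → G g → ∀ (i : ℕ) → G (pow g i)
  pow-closed sg Gg zero    = IsSubgroup.has-e sg
  pow-closed sg Gg (suc i) = IsSubgroup.mul sg Gg (pow-closed sg Gg i)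

  distinct⇒lookup-injective : ∀ {xs : List (Perm n)} → AllPairs (λ g h → ¬ (g ≈ h)) xs →
                              ∀ i j → lookup xs i ≈ lookup xs j → i ≡ j
  distinct⇒lookup-injective {xs} ps i j eq with i Fin.≟ j
  ... | yes i≡j = i≡j
  ... | no  i≢j = contradiction eq (lookup-pairs (λ ne eq → ne (sym ∘ eq)) ps i j i≢j)

  -- Elements are counted up to `≈`: permutations are compared by their values, not as records.
  record Card (P : Perm n → Set) (m : ℕ) : Set where
    field
      at        : Fin m → Perm n
      sound     : ∀ i → P (at i)
      injective : ∀ i j → at i ≈ at j → i ≡ j
      complete  : ∀ g → P g → ∃ λ i → g ≈ at i

  module _ {P : Perm n → Set} {m : ℕ} (M : Card P m) where
    open Card M

    -- The map i ↦ (j , σ j · φ i · π j) is injective.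
    card-bound : ∀ {k l} (φ : Fin k → Perm n) → (∀ i j → φ i ≈ φ j → i ≡ j) →
                 (σ π : Fin l → Perm n) →
                 (∀ i → ∃ λ j → P ((σ j · φ i) · π j)) → k ≤ l * m
    card-bound {k} {l} φ φ-inj σ π cover = Fin.injective⇒≤ {f = λ i → combine (lab i) (idx i)} inj
      where
      lab : Fin k → Fin l
      lab i = proj₁ (cover i)
      idx : Fin k → Fin m
      idx i = proj₁ (complete _ (proj₂ (cover i)))
      spec : ∀ i → ((σ (lab i) · φ i) · π (lab i)) ≈ at (idx i)
      spec i = proj₂ (complete _ (proj₂ (cover i)))
      same : ∀ i j → lab i ≡ lab j → idx i ≡ idx j → φ i ≈ φ j
      same i j eq₁ eq₂ x = begin
        app (φ i) x                            ≡⟨ cong (app (φ i)) (⁻¹-cancelʳ (π (lab i)) x) ⟨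
        app (φ i) (app (π (lab i)) y)          ≡⟨ app-injective (σ (lab i)) eq ⟩
        app (φ j) (app (π (lab i)) y)          ≡⟨ cong (app (φ j)) (⁻¹-cancelʳ (π (lab i)) x) ⟩
        app (φ j) x                            ∎
        where
        open ≡-Reasoning
        y = app (π (lab i) ⁻¹) x
        eq : app (σ (lab i)) (app (φ i) (app (π (lab i)) y)) ≡
             app (σ (lab i)) (app (φ j) (app (π (lab i)) y))
        eq = trans (spec i y) (trans (cong (λ u → app (at u) y) eq₂)
               (trans (sym (spec j y))
                 (cong (λ u → app (σ u) (app (φ j) (app (π u) y))) (sym eq₁))))
      inj : ∀ {i j} → combine (lab i) (idx i) ≡ combine (lab j) (idx j) → i ≡ j
      inj {i} {j} eq with Fin.combine-injective (lab i) (idx i) (lab j) (idx j) eq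
      ... | eq₁ , eq₂ = φ-inj i j (same i j eq₁ eq₂)

    -- The translates `t u · P` partition `Q`. Every index computation below has this form.
    card-cosets : ∀ {l} {Q : Perm n → Set} (t : Fin l → Perm n) →
                  (∀ u q → P q → Q (t u · q)) →
                  (∀ g → Q g → ∃ λ u → P ((t u ⁻¹) · g)) →
                  (∀ u v q q′ → P q → P q′ → (t u · q) ≈ (t v · q′) → u ≡ v) →
                  Card Q (l * m)
    card-cosets {l} {Q} t fwd bwd uniq = record
      { at        = λ i → f (proj₁ (remQuot {l} m i)) (proj₂ (remQuot {l} m i))
      ; sound     = λ i → fwd _ _ (sound _)
      ; injective = inj
      ; complete  = comp
      }
      where
      f : Fin l → Fin m → Perm n
      f u j = t u · at j
      f-inj : ∀ u v i j → f u i ≈ f v j → combine u i ≡ combine v j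
      f-inj u v i j eq with uniq u v (at i) (at j) (sound i) (sound j) eq
      ... | refl = cong (combine u) (injective i j (λ x → app-injective (t u) (eq x)))
      inj : ∀ i j → f (proj₁ (remQuot {l} m i)) (proj₂ (remQuot {l} m i)) ≈
                    f (proj₁ (remQuot {l} m j)) (proj₂ (remQuot {l} m j)) → i ≡ j
      inj i j eq = trans (sym (Fin.combine-remQuot {l} m i))
        (trans (f-inj _ _ _ _ eq) (Fin.combine-remQuot {l} m j))
      comp : ∀ g → Q g → ∃ λ i → g ≈ f (proj₁ (remQuot {l} m i)) (proj₂ (remQuot {l} m i))
      comp g Qg with bwd g Qg
      ... | u , Pq with complete _ Pq
      ... | j , eq = combine u j , λ x →
        trans (trans (sym (⁻¹-cancelʳ (t u) _)) (cong (app (t u)) (eq x)))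
              (cong (λ c → app (f (proj₁ c) (proj₂ c)) x) (sym (Fin.remQuot-combine u j)))

  Card-unique : ∀ {P : Perm n → Set} {k l} → Card P k → Card P l → k ≡ l
  Card-unique K L = ℕ.≤-antisym (le K L) (le L K)
    where
    le : ∀ {P : Perm n → Set} {k l} → Card P k → Card P l → k ≤ l
    le {k = k} {l} K L = subst (k ≤_) (ℕ.*-identityˡ l)
      (card-bound L (Card.at K) (Card.injective K) (λ (_ : Fin 1) → e) (λ _ → e)
        (λ i → zero , Card.sound K i))

  fromList : ∀ {P : Perm n → Set} (xs : List (Perm n)) → All P xs →
             AllPairs (λ g h → ¬ (g ≈ h)) xs → (∀ g → P g → Any (g ≈_) xs) →
             Card P (length xs)
  fromList xs ps ds co = record
    { at        = lookup xs
    ; sound     = λ i → All.lookup ps (∈-lookup i)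
    ; injective = distinct⇒lookup-injective ds
    ; complete  = λ g Pg → Any.index (co g Pg) , Any.lookup-index (co g Pg)
    }

  -- Greedy construction: the conditions are met one at a time, each step keeping those met before.
  extend-all : ∀ {N} {S : Perm n → Set} (Q : Perm n → Fin N → Set) → ∃ S →
               (∀ c i → S c → ∃ λ c′ → S c′ × Q c′ i × (∀ j → Q c j → Q c′ j)) →
               ∃ λ c → S c × (∀ i → Q c i)
  extend-all {zero}  Q (c , Sc) step = c , Sc , λ ()
  extend-all {suc N} {S} Q start step with extend-all {N} (λ c i → Q c (suc i)) start
      (λ c i Sc → let c′ , Sc′ , new , old = step c (suc i) Sc in c′ , Sc′ , new , λ j → old (suc j))
  ... | c , Sc , all with step c zero Sc
  ... | c′ , Sc′ , new , old = c′ , Sc′ , λ { zero → new ; (suc j) → old (suc j) (all j) }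

module Setting
  (p : ℕ) (p-prime : Prime p) (5≤p : 5 ≤ p)
  (G : Perm (3 * p) → Set) (G-sub : IsSubgroup G) (G-trans : Transitive G)
  (blk : Fin (3 * p) → Fin p) (blocks₃ : BlocksOfSize3 blk)
  (unique-blocks : UniqueNontrivialBlockSystem blk G)
  (K-nontrivial : Nontrivial (Kernel blk G))
  (K-fixes-point : ∀ k → Kernel blk G k → ∃ λ x → app k x ≡ x)
  (a : Perm (3 * p)) (Ga : G a) (aᵖ≈e : pow a p ≈ e)
  (a-blocks : ∀ k i → 0 < k → k < p → ¬ FixesBlock blk (pow a k) i)
  (b : Perm (3 * p)) (Gb : G b) (d : ℕ) (0<d : 0 < d)
  (bᵈ∈K : SameOnBlocks blk (pow b d) e)
  (b-order : ∀ k → 0 < k → k < d → ¬ SameOnBlocks blk (pow b k) e)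
  (i₀ : Fin p) (b-fixes : FixesBlock blk b i₀)
  (t : ℕ) (ba∼aᵗb : SameOnBlocks blk ((b · a) · (b ⁻¹)) (pow a t))
  (generated : ∀ g → G g → ∃ λ h → Gen (λ x → (x ≈ a) ⊎ (x ≈ b)) h × SameOnBlocks blk g h)
  where

  -- Blocks of size three and invariant relations

  open IsSubgroup G-sub renaming (has-e to G-e; resp to G-resp; mul to G-mul; inv to G-inv)

  Ω : Set
  Ω = Fin (3 * p)

  K : Perm (3 * p) → Set
  K = Kernel blk G

  infix 4 _~_ _∼_
  _~_ : Ω → Ω → Set
  x ~ y = blk x ≡ blk y

  _∼_ : Perm (3 * p) → Perm (3 * p) → Set
  _∼_ = SameOnBlocks blk

  preserves-blocks : ∀ {g} → G g → ∀ {x y} → x ~ y → app g x ~ app g y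
  preserves-blocks Gg = proj₁ unique-blocks _ Gg _ _

  reflects-blocks : ∀ {g} → G g → ∀ {x y} → app g x ~ app g y → x ~ y
  reflects-blocks {g} Gg {x} {y} eq = subst₂ _~_ (⁻¹-cancelˡ g x) (⁻¹-cancelˡ g y)
    (preserves-blocks (G-inv Gg) eq)

  block-points : ∀ i → Σ (Fin 3 → Ω) λ q → (∀ u → blk (q u) ≡ i)
               × (∀ u v → q u ≡ q v → u ≡ v) × (∀ x → blk x ≡ i → ∃ λ u → x ≡ q u)
  block-points i with blocks₃ i
  ... | x , y , z , (x∈i , y∈i , z∈i , x≢y , x≢z , y≢z) , xyz = q , q∈i , q-inj , q-all
    where
    q : Fin 3 → Ω
    q zero             = x
    q (suc zero)       = y
    q (suc (suc zero)) = z
    q∈i : ∀ u → blk (q u) ≡ i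
    q∈i zero             = x∈i
    q∈i (suc zero)       = y∈i
    q∈i (suc (suc zero)) = z∈i
    q-inj : ∀ u v → q u ≡ q v → u ≡ v
    q-inj zero             zero             _  = refl
    q-inj zero             (suc zero)       eq = contradiction eq x≢y
    q-inj zero             (suc (suc zero)) eq = contradiction eq x≢z
    q-inj (suc zero)       zero             eq = contradiction (sym eq) x≢y
    q-inj (suc zero)       (suc zero)       _  = refl
    q-inj (suc zero)       (suc (suc zero)) eq = contradiction eq y≢z
    q-inj (suc (suc zero)) zero             eq = contradiction (sym eq) x≢z
    q-inj (suc (suc zero)) (suc zero)       eq = contradiction (sym eq) y≢z
    q-inj (suc (suc zero)) (suc (suc zero)) _  = refl
    q-all : ∀ w → blk w ≡ i → ∃ λ u → w ≡ q u
    q-all w w∈i with xyz w w∈i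
    ... | inj₁ w≡x        = zero , w≡x
    ... | inj₂ (inj₁ w≡y) = suc zero , w≡y
    ... | inj₂ (inj₂ w≡z) = suc (suc zero) , w≡z

  base : Fin 3 → Ω
  base = proj₁ (block-points i₀)

  blk-base : ∀ u → blk (base u) ≡ i₀
  blk-base = proj₁ (proj₂ (block-points i₀))

  base-injective : ∀ u v → base u ≡ base v → u ≡ v
  base-injective = proj₁ (proj₂ (proj₂ (block-points i₀)))

  base-complete : ∀ x → blk x ≡ i₀ → ∃ λ u → x ≡ base u
  base-complete = proj₂ (proj₂ (proj₂ (block-points i₀)))

  -- The hypothesis on all invariant partitions, applied to "x ≡ y or P", decides P.
  opaque
    lem : (P : Set) → Dec P
    lem P with proj₂ unique-blocks (λ x y → x ≡ y ⊎ P)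
        ( record { refl = inj₁ refl
                 ; sym = λ { (inj₁ eq) → inj₁ (sym eq) ; (inj₂ h) → inj₂ h }
                 ; trans = λ { (inj₁ eq) (inj₁ eq′) → inj₁ (trans eq eq′)
                             ; (inj₂ h) _ → inj₂ h ; (inj₁ _) (inj₂ h) → inj₂ h } }
        , λ { g _ x y (inj₁ eq) → inj₁ (cong (app g) eq) ; g _ x y (inj₂ h) → inj₂ h })
    ... | inj₁ (inj₁ total) = from≢ (total (base zero) (base (suc zero)))
      where
      from≢ : base zero ≡ base (suc zero) ⊎ P → Dec P
      from≢ (inj₁ eq) with base-injective zero (suc zero) eq
      ... | ()
      from≢ (inj₂ h) = yes h
    ... | inj₁ (inj₂ discrete) = no from-P
      where
      from-P : ¬ P
      from-P h with base-injective zero (suc zero) (discrete _ _ (inj₂ h))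
      ... | ()
    ... | inj₂ iff = from≢ (Equivalence.from (iff (base zero) (base (suc zero)))
                              (trans (blk-base zero) (sym (blk-base (suc zero)))))
      where
      from≢ : base zero ≡ base (suc zero) ⊎ P → Dec P
      from≢ (inj₁ eq) with base-injective zero (suc zero) eq
      ... | ()
      from≢ (inj₂ h) = yes h

  by-contradiction : {P : Set} → ¬ ¬ P → P
  by-contradiction {P} ¬¬p with lem P
  ... | yes h = h
  ... | no ¬h = contradiction ¬h ¬¬p

  opaque
    -- Two distinct points of one block are related by `R`, which rules out the discrete partition
    -- and leaves the two other possibilities.
    coarser : (R : Ω → Ω → Set) → InvariantPartition G R → (∀ {x y} → x ~ y → R x y) →
              (∀ x y → R x y) ⊎ (∀ x y → R x y → x ~ y)
    coarser R R-inv ~⊆R with proj₂ unique-blocks R R-inv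
    ... | inj₁ (inj₁ total) = inj₁ total
    ... | inj₁ (inj₂ discrete)
      with base-injective zero (suc zero)
             (discrete _ _ (~⊆R (trans (blk-base zero) (sym (blk-base (suc zero))))))
    ...   | ()
    coarser R R-inv ~⊆R | inj₂ iff = inj₂ λ x y → Equivalence.to (iff x y)

  -- The action of the powers of `a` on the blocks

  instance
    p-nonZero : NonZero p
    p-nonZero = prime⇒nonZero p-prime

  G-pow : ∀ {g} → G g → ∀ (i : ℕ) → G (pow g i)
  G-pow = pow-closed G-sub

  a^ : ℕ → Perm (3 * p)
  a^ = pow a

  Ga^ : ∀ i → G (a^ i)
  Ga^ = G-pow Ga

  a^-multiple : ∀ q x → app (a^ (q * p)) x ≡ x
  a^-multiple zero    x = refl
  a^-multiple (suc q) x = trans (pow-+ a p (q * p) x) (trans (aᵖ≈e _) (a^-multiple q x))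

  a^-+∸ : ∀ {i j} → i ≤ j → ∀ x → app (a^ j) x ≡ app (a^ i) (app (a^ (j ∸ i)) x)
  a^-+∸ {i} {j} i≤j x = trans (cong (λ m → app (a^ m) x) (sym (ℕ.m+[n∸m]≡n i≤j)))
                              (pow-+ a i (j ∸ i) x)

  a^-periodic-≤ : ∀ {i j} → i ≤ j → p ∣ ∣ i - j ∣ → a^ i ≈ a^ j
  a^-periodic-≤ {i} {j} i≤j (divides q eq) x = sym (trans (a^-+∸ i≤j x) (cong (app (a^ i))
      (trans (cong (λ m → app (a^ m) x) (trans (sym (ℕ.m≤n⇒∣m-n∣≡n∸m i≤j)) eq)) (a^-multiple q x))))

  a^-periodic : ∀ i j → p ∣ ∣ i - j ∣ → a^ i ≈ a^ j
  a^-periodic i j p∣ with ℕ.≤-total i j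
  ... | inj₁ i≤j = a^-periodic-≤ i≤j p∣
  ... | inj₂ j≤i = λ x → sym (a^-periodic-≤ j≤i (subst (p ∣_) (ℕ.∣-∣-comm i j) p∣) x)

  -- Only the remainder of `m` modulo `p` matters, and a nonzero remainder gives a power of `a` that
  -- fixes no block.
  a^-fixes : ∀ m {x} → app (a^ m) x ~ x → p ∣ m
  a^-fixes m {x} eq with m % p in rem
  ... | zero = m%n≡0⇒n∣m m p rem
  ... | suc r = contradiction fixes
          (a-blocks (suc r) (blk x) (s≤s z≤n) (subst (_< p) rem (m%n<n m p)))
    where
    same : app (a^ m) x ≡ app (a^ (suc r)) x
    same = begin
      app (a^ m) x                                    ≡⟨ cong (λ k → app (a^ k) x) (m≡m%n+[m/n]*n m p) ⟩
      app (a^ (m % p + (m / p) * p)) x                ≡⟨ pow-+ a (m % p) _ x ⟩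
      app (a^ (m % p)) (app (a^ ((m / p) * p)) x)     ≡⟨ cong (app (a^ (m % p))) (a^-multiple (m / p) x) ⟩
      app (a^ (m % p)) x                              ≡⟨ cong (λ k → app (a^ k) x) rem ⟩
      app (a^ (suc r)) x                              ∎
      where open ≡-Reasoning
    fixes : FixesBlock blk (a^ (suc r)) (blk x)
    fixes y y~x = trans (preserves-blocks (Ga^ (suc r)) y~x) (trans (sym (cong blk same)) eq)

  a^-agree-≤ : ∀ {i j x} → i ≤ j → app (a^ i) x ~ app (a^ j) x → p ∣ ∣ i - j ∣
  a^-agree-≤ {i} {j} i≤j eq = subst (p ∣_) (sym (ℕ.m≤n⇒∣m-n∣≡n∸m i≤j))
    (a^-fixes (j ∸ i) (sym (reflects-blocks (Ga^ i) (trans eq (cong blk (a^-+∸ i≤j _))))))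

  a^-agree : ∀ i j {x} → app (a^ i) x ~ app (a^ j) x → p ∣ ∣ i - j ∣
  a^-agree i j eq with ℕ.≤-total i j
  ... | inj₁ i≤j = a^-agree-≤ i≤j eq
  ... | inj₂ j≤i = subst (p ∣_) (ℕ.∣-∣-comm j i) (a^-agree-≤ j≤i (sym eq))

  a^-determined : ∀ i j {x} → app (a^ i) x ~ app (a^ j) x → a^ i ≈ a^ j
  a^-determined i j eq = a^-periodic i j (a^-agree i j eq)

  opaque
    -- The first `p` powers of `a` move the block of `x` to `p` different blocks, and there are no
    -- others.
    a-transitive-on-blocks : ∀ x y → ∃ λ m → y ~ app (a^ m) x
    a-transitive-on-blocks x y with injective⇒surjective (λ i → blk (app (a^ (toℕ i)) x)) inj (blk y)
      where
      inj : ∀ {i j : Fin p} → app (a^ (toℕ i)) x ~ app (a^ (toℕ j)) x → i ≡ j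
      inj {i} {j} eq = Fin.toℕ-injective (small (a^-agree (toℕ i) (toℕ j) eq))
        where
        bound : ∣ toℕ i - toℕ j ∣ < p
        bound = ℕ.≤-<-trans (ℕ.∣m-n∣≤m⊔n (toℕ i) (toℕ j))
                  (ℕ.⊔-lub (Fin.toℕ<n i) (Fin.toℕ<n j))
        small : p ∣ ∣ toℕ i - toℕ j ∣ → toℕ i ≡ toℕ j
        small p∣ = by-contradiction λ ne →
          >⇒∤ {{ℕ.≢-nonZero (λ z → ne (ℕ.∣m-n∣≡0⇒m≡n z))}} bound p∣
    ... | m , eq = toℕ m , sym eq

  -- Normal forms modulo `K` and the affine action on the blocks

  twist : ∀ {γ τ} → G γ → (∀ x → app γ (app a x) ~ app (a^ τ) (app γ x)) →
          ∀ s x → app γ (app (a^ s) x) ~ app (a^ (s * τ)) (app γ x)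
  twist Gγ tw zero    x = refl
  twist {γ} {τ} Gγ tw (suc s) x = begin
    blk (app γ (app a (app (a^ s) x)))             ≡⟨ tw _ ⟩
    blk (app (a^ τ) (app γ (app (a^ s) x)))        ≡⟨ preserves-blocks (Ga^ τ) (twist {γ} {τ} Gγ tw s x) ⟩
    blk (app (a^ τ) (app (a^ (s * τ)) (app γ x)))  ≡⟨ cong blk (pow-+ a τ (s * τ) _) ⟨
    blk (app (a^ (τ + s * τ)) (app γ x))           ∎
    where open ≡-Reasoning

  b^ : ℕ → Perm (3 * p)
  b^ = pow b

  Gb^ : ∀ j → G (b^ j)
  Gb^ = G-pow Gb

  ba~aᵗb : ∀ x → app b (app a x) ~ app (a^ t) (app b x)
  ba~aᵗb x = trans (cong (λ y → blk (app b (app a y))) (sym (⁻¹-cancelˡ b x))) (ba∼aᵗb (app b x))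

  -- The exponent obtained is the `j`-th power of `t`.
  b^-twist : ∀ j → ∃ λ τ → ∀ x → app (b^ j) (app a x) ~ app (a^ τ) (app (b^ j) x)
  b^-twist zero = 1 , λ x → refl
  b^-twist (suc j) with b^-twist j
  ... | τ , tw = τ * t , λ x → trans (preserves-blocks Gb (tw x)) (twist {b} {t} Gb ba~aᵗb τ _)

  b^-multiple : ∀ q x → app (b^ (q * d)) x ~ x
  b^-multiple zero    x = refl
  b^-multiple (suc q) x = trans (cong blk (pow-+ b d (q * d) x)) (trans (bᵈ∈K _) (b^-multiple q x))

  NormalForm : Perm (3 * p) → Set
  NormalForm g = ∃ λ s → ∃ λ j → g ∼ (a^ s · b^ j)

  normal-form-· : ∀ {g h} → G g → NormalForm g → NormalForm h → NormalForm (g · h)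
  normal-form-· {g} {h} Gg (s , j , g∼) (s′ , j′ , h∼) with b^-twist j
  ... | τ , tw = s + s′ * τ , j + j′ , λ x → begin
    blk (app g (app h x))                                                ≡⟨ preserves-blocks Gg (h∼ x) ⟩
    blk (app g (app (a^ s′) (app (b^ j′) x)))                            ≡⟨ g∼ _ ⟩
    blk (app (a^ s) (app (b^ j) (app (a^ s′) (app (b^ j′) x))))          ≡⟨ preserves-blocks (Ga^ s) (twist {b^ j} {τ} (Gb^ j) tw s′ _) ⟩
    blk (app (a^ s) (app (a^ (s′ * τ)) (app (b^ j) (app (b^ j′) x))))    ≡⟨ cong blk (pow-+ a s (s′ * τ) _) ⟨
    blk (app (a^ (s + s′ * τ)) (app (b^ j) (app (b^ j′) x)))             ≡⟨ cong (λ y → blk (app (a^ (s + s′ * τ)) y)) (pow-+ b j j′ x) ⟨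
    blk (app (a^ (s + s′ * τ)) (app (b^ (j + j′)) x))                    ∎
    where open ≡-Reasoning

  -- Exponents are natural numbers, so modulo `K` the inverses of `a^ s` and `b^ j` are written with
  -- exponents `s` times `p` minus 1 and `j` times `d` minus 1. Their product in reversed order is
  -- then brought to normal form again.
  normal-form-⁻¹ : ∀ {g} → NormalForm g → NormalForm (g ⁻¹)
  normal-form-⁻¹ {g} (s , j , g∼) with normal-form-· {B} {A} (Gb^ (j * ℕ.pred d)) (0 , j * ℕ.pred d , λ x → refl)
                                                     (s * ℕ.pred p , 0 , λ x → refl)
    where
    A = a^ (s * ℕ.pred p)
    B = b^ (j * ℕ.pred d)
  ... | s′ , j′ , BA∼ = s′ , j′ , λ x → trans (sym (inverse x)) (BA∼ x)
    where
    instance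
      d-nonZero : NonZero d
      d-nonZero = ℕ.>-nonZero 0<d
    A = a^ (s * ℕ.pred p)
    B = b^ (j * ℕ.pred d)
    m*pred+m : ∀ m n → .{{NonZero n}} → m * ℕ.pred n + m ≡ m * n
    m*pred+m m n = trans (ℕ.+-comm _ m) (trans (sym (ℕ.*-suc m (ℕ.pred n))) (cong (m *_) (ℕ.suc-pred n)))
    A-cancel : ∀ x → app A (app (a^ s) x) ≡ x
    A-cancel x = trans (sym (pow-+ a (s * ℕ.pred p) s x))
      (trans (cong (λ m → app (a^ m) x) (m*pred+m s p)) (a^-multiple s x))
    B-cancel : ∀ x → app B (app (b^ j) x) ~ x
    B-cancel x = trans (cong blk (sym (pow-+ b (j * ℕ.pred d) j x)))
      (trans (cong (λ m → blk (app (b^ m) x)) (m*pred+m j d)) (b^-multiple j x))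
    inverse : ∀ x → app B (app A x) ~ app (g ⁻¹) x
    inverse x = begin
      blk (app B (app A x))                                 ≡⟨ cong (λ z → blk (app B (app A z))) (⁻¹-cancelʳ g x) ⟨
      blk (app B (app A (app g y)))                         ≡⟨ preserves-blocks (Gb^ (j * ℕ.pred d)) (preserves-blocks (Ga^ (s * ℕ.pred p)) (g∼ y)) ⟩
      blk (app B (app A (app (a^ s) (app (b^ j) y))))       ≡⟨ cong (λ z → blk (app B z)) (A-cancel _) ⟩
      blk (app B (app (b^ j) y))                            ≡⟨ B-cancel y ⟩
      blk y                                                 ∎
      where
      open ≡-Reasoning
      y = app (g ⁻¹) x

  ⟨a,b⟩-normal-form : ∀ {g} → Gen (λ x → (x ≈ a) ⊎ (x ≈ b)) g → G g × NormalForm g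
  ⟨a,b⟩-normal-form (gen (inj₁ g≈a)) = G-resp (sym ∘ g≈a) Ga , 1 , 0 , λ x → cong blk (g≈a x)
  ⟨a,b⟩-normal-form (gen (inj₂ g≈b)) = G-resp (sym ∘ g≈b) Gb , 0 , 1 , λ x → cong blk (g≈b x)
  ⟨a,b⟩-normal-form one = G-e , 0 , 0 , λ x → refl
  ⟨a,b⟩-normal-form (mul {g} {h} g∈ h∈) with ⟨a,b⟩-normal-form g∈ | ⟨a,b⟩-normal-form h∈
  ... | Gg , nf-g | Gh , nf-h = G-mul Gg Gh , normal-form-· {g} {h} Gg nf-g nf-h
  ⟨a,b⟩-normal-form (inv {g} g∈) with ⟨a,b⟩-normal-form g∈
  ... | Gg , nf-g = G-inv Gg , normal-form-⁻¹ {g} nf-g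
  ⟨a,b⟩-normal-form (resp g≈h g∈) with ⟨a,b⟩-normal-form g∈
  ... | Gg , s , j , g∼ = G-resp g≈h Gg , s , j , λ x → trans (cong blk (sym (g≈h x))) (g∼ x)

  opaque
    -- Since `b^ d` acts trivially on the blocks, the exponent of `b` can be reduced modulo `d`. It
    -- becomes the label by which families are split into `d` parts.
    normal-form : ∀ {g} → G g → ∃ λ s → Σ (Fin d) λ j → g ∼ (a^ s · b^ (toℕ j))
    normal-form {g} Gg with generated g Gg
    ... | h , h∈ , g∼h with proj₂ (⟨a,b⟩-normal-form h∈)
    ... | s , j , h∼ = s , fromℕ< (m%n<n j d) , λ x → trans (g∼h x) (trans (h∼ x)
            (preserves-blocks (Ga^ s) (reduce x)))
      where
      instance
        d-nonZero : NonZero d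
        d-nonZero = ℕ.>-nonZero 0<d
      reduce : ∀ x → app (b^ j) x ~ app (b^ (toℕ (fromℕ< (m%n<n j d)))) x
      reduce x = begin
        blk (app (b^ j) x)                                      ≡⟨ cong (λ k → blk (app (b^ k) x)) (m≡m%n+[m/n]*n j d) ⟩
        blk (app (b^ (j % d + (j / d) * d)) x)                  ≡⟨ cong blk (pow-+ b (j % d) _ x) ⟩
        blk (app (b^ (j % d)) (app (b^ ((j / d) * d)) x))       ≡⟨ preserves-blocks (Gb^ (j % d)) (b^-multiple (j / d) x) ⟩
        blk (app (b^ (j % d)) x)                                ≡⟨ cong (λ k → blk (app (b^ k) x)) (Fin.toℕ-fromℕ< (m%n<n j d)) ⟨
        blk (app (b^ (toℕ (fromℕ< (m%n<n j d)))) x)             ∎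
        where open ≡-Reasoning

  opaque
    -- Powers of `a` commute, so `τ` comes from the power of `b` in the normal form alone.
    G-twist : ∀ {γ} → G γ → ∃ λ τ → ∀ x → app γ (app a x) ~ app (a^ τ) (app γ x)
    G-twist {γ} Gγ with normal-form Gγ
    ... | s , j , γ∼ with b^-twist (toℕ j)
    ... | τ , tw = τ , λ x → begin
      blk (app γ (app a x))                                    ≡⟨ γ∼ _ ⟩
      blk (app (a^ s) (app (b^ (toℕ j)) (app a x)))            ≡⟨ preserves-blocks (Ga^ s) (tw x) ⟩
      blk (app (a^ s) (app (a^ τ) (app (b^ (toℕ j)) x)))       ≡⟨ cong blk (pow-+ a s τ _) ⟨
      blk (app (a^ (s + τ)) (app (b^ (toℕ j)) x))              ≡⟨ cong (λ m → blk (app (a^ m) (app (b^ (toℕ j)) x))) (ℕ.+-comm s τ) ⟩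
      blk (app (a^ (τ + s)) (app (b^ (toℕ j)) x))              ≡⟨ cong blk (pow-+ a τ s _) ⟩
      blk (app (a^ τ) (app (a^ s) (app (b^ (toℕ j)) x)))       ≡⟨ preserves-blocks (Ga^ τ) (γ∼ x) ⟨
      blk (app (a^ τ) (app γ x))                               ∎
      where
      open ≡-Reasoning

  -- The powers of `b` coincide, and a power of `a` is determined by its action on a single block.
  same-label-agree : ∀ {g h} s s′ j → g ∼ (a^ s · b^ j) → h ∼ (a^ s′ · b^ j) →
                     ∀ {x} → app g x ~ app h x → g ∼ h
  same-label-agree s s′ j g∼ h∼ {x} gx~hx y = trans (g∼ y) (trans
    (cong blk (a^-determined s s′ (trans (sym (g∼ x)) (trans gx~hx (h∼ x))) _)) (sym (h∼ y)))

  b^-distinct : ∀ i j → i < j → j < d → ¬ (b^ i ∼ b^ j)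
  b^-distinct i j i<j j<d eq = b-order (j ∸ i) (ℕ.m<n⇒0<n∸m i<j) (ℕ.≤-<-trans (ℕ.m∸n≤m j i) j<d)
    λ x → sym (reflects-blocks (Gb^ i) (trans (eq x) (cong blk
      (trans (cong (λ m → app (b^ m) x) (sym (ℕ.m+[n∸m]≡n (ℕ.<⇒≤ i<j)))) (pow-+ b i (j ∸ i) x)))))

  b^-injective : ∀ (i j : Fin d) → b^ (toℕ i) ∼ b^ (toℕ j) → i ≡ j
  b^-injective i j eq with ℕ.<-cmp (toℕ i) (toℕ j)
  ... | tri< i<j _ _ = contradiction eq (b^-distinct _ _ i<j (Fin.toℕ<n j))
  ... | tri≈ _ i≡j _ = Fin.toℕ-injective i≡j
  ... | tri> _ _ j<i = contradiction (λ x → sym (eq x)) (b^-distinct _ _ j<i (Fin.toℕ<n i))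

  -- An affine map x ↦ τ x + c of ℤ/p with two fixed points has τ = 1 and then c = 0.
  fixes-two-blocks : ∀ {γ} → G γ → ∀ {x y} → app γ x ~ x → app γ y ~ y → ¬ (x ~ y) →
                     ∀ z → app γ z ~ z
  fixes-two-blocks {γ} Gγ {x} {y} γx~x γy~y x≁y z with a-transitive-on-blocks x y | G-twist Gγ
  ... | m , y~ | τ , tw = go (euclidsLemma m ∣ τ - 1 ∣ p-prime p∣m*)
    where
    open ≡-Reasoning
    agree : app (a^ (m * τ)) x ~ app (a^ (m * 1)) x
    agree = begin
      blk (app (a^ (m * τ)) x)           ≡⟨ preserves-blocks (Ga^ (m * τ)) γx~x ⟨
      blk (app (a^ (m * τ)) (app γ x))   ≡⟨ twist {γ} {τ} Gγ tw m x ⟨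
      blk (app γ (app (a^ m) x))         ≡⟨ preserves-blocks Gγ y~ ⟨
      blk (app γ y)                      ≡⟨ γy~y ⟩
      blk y                              ≡⟨ y~ ⟩
      blk (app (a^ m) x)                 ≡⟨ cong (λ k → blk (app (a^ k) x)) (ℕ.*-identityʳ m) ⟨
      blk (app (a^ (m * 1)) x)           ∎
    p∣m* : p ∣ m * ∣ τ - 1 ∣
    p∣m* = subst (p ∣_) (sym (ℕ.*-distribˡ-∣-∣ m τ 1)) (a^-agree (m * τ) (m * 1) agree)
    go : p ∣ m ⊎ p ∣ ∣ τ - 1 ∣ → app γ z ~ z
    -- If `p` divides `m`, then `a^ m` is the identity and `y` lies in the block of `x`.
    go (inj₁ (divides q eq)) = contradiction
      (sym (trans y~ (cong blk (trans (cong (λ k → app (a^ k) x) eq) (a^-multiple q x))))) x≁y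
    -- Otherwise `γ` commutes with `a` on the blocks, so fixing the block of `x` it fixes all its
    -- translates.
    go (inj₂ p∣τ-1) with a-transitive-on-blocks x z
    ... | k , z~ = begin
      blk (app γ z)                      ≡⟨ preserves-blocks Gγ z~ ⟩
      blk (app γ (app (a^ k) x))         ≡⟨ twist {γ} {1} Gγ (λ w → trans (tw w) (cong blk (a^-periodic τ 1 p∣τ-1 _))) k x ⟩
      blk (app (a^ (k * 1)) (app γ x))   ≡⟨ preserves-blocks (Ga^ (k * 1)) γx~x ⟩
      blk (app (a^ (k * 1)) x)           ≡⟨ cong (λ l → blk (app (a^ l) x)) (ℕ.*-identityʳ k) ⟩
      blk (app (a^ k) x)                 ≡⟨ z~ ⟨
      blk z                              ∎

  -- Labels of points and a cyclic order on each block

  next : Fin 3 → Fin 3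
  next zero             = suc zero
  next (suc zero)       = suc (suc zero)
  next (suc (suc zero)) = zero

  next-cyclic : ∀ u → next (next (next u)) ≡ u
  next-cyclic zero             = refl
  next-cyclic (suc zero)       = refl
  next-cyclic (suc (suc zero)) = refl

  next-≢ : ∀ u → next u ≢ u
  next-≢ zero             ()
  next-≢ (suc zero)       ()
  next-≢ (suc (suc zero)) ()

  next-cover : ∀ u v → v ≡ u ⊎ v ≡ next u ⊎ v ≡ next (next u)
  next-cover zero             zero             = inj₁ refl
  next-cover zero             (suc zero)       = inj₂ (inj₁ refl)
  next-cover zero             (suc (suc zero)) = inj₂ (inj₂ refl)
  next-cover (suc zero)       zero             = inj₂ (inj₂ refl)
  next-cover (suc zero)       (suc zero)       = inj₁ refl
  next-cover (suc zero)       (suc (suc zero)) = inj₂ (inj₁ refl)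
  next-cover (suc (suc zero)) zero             = inj₂ (inj₁ refl)
  next-cover (suc (suc zero)) (suc zero)       = inj₂ (inj₂ refl)
  next-cover (suc (suc zero)) (suc (suc zero)) = inj₁ refl

  opaque
    label : ∀ x → ∃ λ m → ∃ λ u → x ≡ app (a^ m) (base u)
    label x with a-transitive-on-blocks (base zero) x
    ... | m , x~ with base-complete (app (a^ m ⁻¹) x)
            (trans (reflects-blocks (Ga^ m) (trans (cong blk (⁻¹-cancelʳ (a^ m) x)) x~)) (blk-base zero))
    ... | u , eq = m , u , trans (sym (⁻¹-cancelʳ (a^ m) x)) (cong (app (a^ m)) eq)

  base-~ : ∀ u v → base u ~ base v
  base-~ u v = trans (blk-base u) (sym (blk-base v))

  -- The exponent in a label is not unique, but the permutation `a^ m` is, because all base points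
  -- lie in one block.
  label-blk : ∀ {m n u v} → app (a^ m) (base u) ~ app (a^ n) (base v) → a^ m ≈ a^ n
  label-blk {m} {n} {u} {v} eq =
    a^-determined m n (trans eq (preserves-blocks (Ga^ n) (base-~ v u)))

  label-unique : ∀ {m n u v} → app (a^ m) (base u) ≡ app (a^ n) (base v) → u ≡ v
  label-unique {m} {n} {u} {v} eq = base-injective u v (app-injective (a^ m)
    (trans eq (sym (label-blk {m} {n} {u} {v} (cong blk eq) (base v)))))

  -- A 3-cycle on every block, built so that it commutes with a.
  r : Ω → Ω
  r x = app (a^ (proj₁ (label x))) (base (next (proj₁ (proj₂ (label x)))))

  -- Makes `r` independent of the labels picked in its definition; order three and commutation with
  -- `a` follow from this.
  r-label : ∀ m u {x} → x ≡ app (a^ m) (base u) → r x ≡ app (a^ m) (base (next u))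
  r-label m u {x} x≡ = trans
    (label-blk {proj₁ (label x)} {m} {proj₁ (proj₂ (label x))} {u} (cong blk eq) _)
    (cong (λ w → app (a^ m) (base (next w))) (label-unique {proj₁ (label x)} {m} eq))
    where
    eq : app (a^ (proj₁ (label x))) (base (proj₁ (proj₂ (label x)))) ≡ app (a^ m) (base u)
    eq = trans (sym (proj₂ (proj₂ (label x)))) x≡

  r-~ : ∀ x → r x ~ x
  r-~ x = let m , u , eq = label x in
    trans (preserves-blocks (Ga^ m) (base-~ (next u) u)) (cong blk (sym eq))

  r-≢ : ∀ x → r x ≢ x
  r-≢ x rx≡x = let m , u , eq = label x in
    next-≢ u (base-injective _ _ (app-injective (a^ m) (trans rx≡x eq)))

  r-a : ∀ x → r (app a x) ≡ app a (r x)
  r-a x = let m , u , eq = label x in r-label (suc m) u (cong (app a) eq)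

  r³-label : ∀ m u {x} → x ≡ app (a^ m) (base u) → r (r (r x)) ≡ x
  r³-label m u {x} eq = begin
    r (r (r x))                                ≡⟨ r-label m (next (next u)) (r-label m (next u) (r-label m u eq)) ⟩
    app (a^ m) (base (next (next (next u))))   ≡⟨ cong (λ v → app (a^ m) (base v)) (next-cyclic u) ⟩
    app (a^ m) (base u)                        ≡⟨ eq ⟨
    x                                          ∎
    where open ≡-Reasoning

  r³ : ∀ x → r (r (r x)) ≡ x
  r³ x = let m , u , eq = label x in r³-label m u eq

  opaque
    r-cover : ∀ {x y} → y ~ x → y ≡ x ⊎ y ≡ r x ⊎ y ≡ r (r x)
    r-cover {x} {y} y~x = find (label x) (label y)
      where
      find : (∃ λ m → ∃ λ u → x ≡ app (a^ m) (base u)) → (∃ λ n → ∃ λ v → y ≡ app (a^ n) (base v)) →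
             y ≡ x ⊎ y ≡ r x ⊎ y ≡ r (r x)
      find (m , u , x≡) (n , v , y≡) with next-cover u v
        | trans y≡ (label-blk {n} {m} {v} {u} (trans (cong blk (sym y≡)) (trans y~x (cong blk x≡))) (base v))
      ... | inj₁ refl        | y≡′ = inj₁ (trans y≡′ (sym x≡))
      ... | inj₂ (inj₁ refl) | y≡′ = inj₂ (inj₁ (trans y≡′ (sym (r-label m u x≡))))
      ... | inj₂ (inj₂ refl) | y≡′ = inj₂ (inj₂ (trans y≡′ (sym (r-label m (next u) (r-label m u x≡)))))

  r-injective : ∀ {x y} → r x ≡ r y → x ≡ y
  r-injective {x} {y} eq = trans (sym (r³ x)) (trans (cong (λ z → r (r z)) eq) (r³ y))

  rr-≢ : ∀ x → r (r x) ≢ x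
  rr-≢ x eq = r-≢ x (trans (cong r (sym eq)) (r³ x))

  -- Parity of a permutation on a block

  rot : Bool → Ω → Ω
  rot false x = r x
  rot true  x = r (r x)

  -- Parity g x σ: the map induced by g on the block of x preserves (σ = false) or reverses
  -- (σ = true) the cyclic order given by r.
  Parity : Perm (3 * p) → Ω → Bool → Set
  Parity g x σ = app g (r x) ≡ rot σ (app g x)

  rot-unique : ∀ {x} σ σ′ → rot σ x ≡ rot σ′ x → σ ≡ σ′
  rot-unique false false _  = refl
  rot-unique false true  eq = contradiction (sym (r-injective eq)) (r-≢ _)
  rot-unique true  false eq = contradiction (r-injective eq) (r-≢ _)
  rot-unique true  true  _  = refl

  parity-unique : ∀ {g x} σ σ′ → Parity g x σ → Parity g x σ′ → σ ≡ σ′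
  parity-unique σ σ′ h h′ = rot-unique σ σ′ (trans (sym h) h′)

  opaque
    -- As `g` is injective and preserves blocks, `r x` goes to one of the two other points in the
    -- block of `app g x`.
    parity : ∀ {g} → G g → ∀ x → ∃ λ σ → Parity g x σ
    parity {g} Gg x with r-cover (preserves-blocks Gg (r-~ x))
    ... | inj₁ eq        = contradiction (app-injective g eq) (r-≢ x)
    ... | inj₂ (inj₁ eq) = false , eq
    ... | inj₂ (inj₂ eq) = true , eq

  -- With different parities at `x` and `r x`, `g` would send `x` and `r (r x)` to the same point.
  parity-r : ∀ {g x} → G g → ∀ σ → Parity g x σ → Parity g (r x) σ
  parity-r {g} {x} Gg σ h with σ | parity Gg (r x)
  ... | false | false , h′ = h′
  ... | true  | true  , h′ = h′
  ... | false | true  , h′ = contradiction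
          (app-injective g (trans h′ (trans (cong (λ y → r (r y)) h) (r³ _)))) (rr-≢ x)
  ... | true  | false , h′ = contradiction
          (app-injective g (trans h′ (trans (cong r h) (r³ _)))) (rr-≢ x)

  parity-block : ∀ {g x y} → G g → ∀ σ → y ~ x → Parity g x σ → Parity g y σ
  parity-block Gg σ y~x h with r-cover y~x
  ... | inj₁ refl        = h
  ... | inj₂ (inj₁ refl) = parity-r Gg σ h
  ... | inj₂ (inj₂ refl) = parity-r Gg σ (parity-r Gg σ h)

  parity-rot : ∀ {g x} → G g → ∀ σ τ → Parity g x σ → app g (rot τ x) ≡ rot (σ xor τ) (app g x)
  parity-rot Gg false false h = h
  parity-rot Gg true  false h = h
  parity-rot Gg false true  h = trans (parity-r Gg false h) (cong r h)
  parity-rot Gg true  true  h = trans (parity-r Gg true h) (trans (cong (λ y → r (r y)) h) (cong r (r³ _)))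

  parity-· : ∀ {g h x} → G g → ∀ σ τ → Parity g (app h x) σ → Parity h x τ → Parity (g · h) x (σ xor τ)
  parity-· {g} Gg σ τ hg hh = trans (cong (app g) hh) (parity-rot Gg σ τ hg)

  Sign : Perm (3 * p) → Bool → Set
  Sign g σ = ∀ x → Parity g x σ

  fixes-block : ∀ {g x} → Parity g x false → app g x ≡ x → ∀ {y} → y ~ x → G g → app g y ≡ y
  fixes-block {g} {x} h gx≡x y~x Gg with r-cover y~x
  ... | inj₁ refl        = gx≡x
  ... | inj₂ (inj₁ refl) = trans h (cong r gx≡x)
  ... | inj₂ (inj₂ refl) = trans (parity-r Gg false h) (cong r (trans h (cong r gx≡x)))

  -- The kernel `K` and its even part `C`

  K-· : ∀ {g h} → K g → K h → K (g · h)
  K-· (Gg , g~) (Gh , h~) = G-mul Gg Gh , λ x → trans (g~ _) (h~ x)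

  K-⁻¹ : ∀ {g} → K g → K (g ⁻¹)
  K-⁻¹ {g} (Gg , g~) = G-inv Gg , λ x → trans (sym (g~ _)) (cong blk (⁻¹-cancelʳ g x))

  K-conj : ∀ {g k} → G g → K k → K ((g · k) · (g ⁻¹))
  K-conj {g} Gg (Gk , k~) = G-mul (G-mul Gg Gk) (G-inv Gg) , λ x →
    trans (preserves-blocks Gg (k~ _)) (cong blk (⁻¹-cancelʳ g x))

  K-quotient : ∀ {g h} → G g → G h → g ∼ h → K ((g ⁻¹) · h)
  K-quotient {g} {h} Gg Gh g∼h = G-mul (G-inv Gg) Gh , λ x →
    trans (preserves-blocks (G-inv Gg) (sym (g∼h x))) (cong blk (⁻¹-cancelˡ g x))

  opaque
    -- Since `K` is normal, its orbits form an invariant partition. It is not discrete because `K`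
    -- is nontrivial, and in both remaining cases the points of a block lie in one orbit.
    K-transitive-on-block : ∀ {x y} → x ~ y → ∃ λ k → K k × app k x ≡ y
    K-transitive-on-block {x} {y} x~y with proj₂ unique-blocks (λ x y → ∃ λ k → K k × app k x ≡ y)
        ( record { refl = e , (G-e , λ _ → refl) , refl
                 ; sym = λ { (k , Kk , refl) → k ⁻¹ , K-⁻¹ {k} Kk , ⁻¹-cancelˡ k _ }
                 ; trans = λ { (k , Kk , refl) (l , Kl , refl) → l · k , K-· {l} {k} Kl Kk , refl } }
        , λ { g Gg x _ (k , Kk , refl) → (g · k) · (g ⁻¹) , K-conj {g} {k} Gg Kk
            , cong (λ z → app g (app k z)) (⁻¹-cancelˡ g x) })
    ... | inj₂ iff = Equivalence.from (iff x y) x~y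
    ... | inj₁ (inj₂ discrete) = let k , Kk , k≉e = K-nontrivial in
      contradiction (λ z → sym (discrete z (app k z) (k , Kk , refl))) k≉e
    ... | inj₁ (inj₁ total) = let k , Kk , kx≡y = total x y in k , Kk , kx≡y

  C : Perm (3 * p) → Set
  C g = K g × Sign g false

  C⊆G : ∀ {c} → C c → G c
  C⊆G ((Gc , _) , _) = Gc

  C-· : ∀ {g h} → C g → C h → C (g · h)
  C-· {g} {h} (Kg , sg) (Kh , sh) = K-· {g} {h} Kg Kh , λ x →
    parity-· {g} {h} (proj₁ Kg) false false (sg _) (sh x)

  -- Both factors act on the same block, hence with the same parity, whatever it is.
  square-∈C : ∀ {k} → K k → C (k · k)
  square-∈C {k} Kk@(Gk , k~) = K-· {k} {k} Kk Kk , λ x →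
    let σ , h = parity Gk x in subst (Parity (k · k) x) (xor-same σ)
      (parity-· {k} {k} Gk σ σ (parity-block {k} Gk σ (k~ x) h) h)

  C-fixes-block : ∀ {c x y} → C c → y ~ x → app c x ≡ x → app c y ≡ y
  C-fixes-block {c} Cc y~x cx = fixes-block {c} (proj₂ Cc _) cx y~x (C⊆G {c} Cc)

  -- An even map commutes with `r`, so its value at `x` determines it on the whole block.
  C-acts : ∀ {c} → C c → ∀ x → (∀ {y} → y ~ x → app c y ≡ y) ⊎
           (∀ {y} → y ~ x → app c y ≡ r y) ⊎ (∀ {y} → y ~ x → app c y ≡ r (r y))
  C-acts {c} Cc@((Gc , c~) , s) x with r-cover (c~ x)
  ... | inj₁ eq        = inj₁ λ y~x → C-fixes-block {c} Cc y~x eq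
  ... | inj₂ (inj₁ eq) = inj₂ (inj₁ λ y~x → act (r-cover y~x))
    where
    act : ∀ {y} → y ≡ x ⊎ y ≡ r x ⊎ y ≡ r (r x) → app c y ≡ r y
    act (inj₁ refl)        = eq
    act (inj₂ (inj₁ refl)) = trans (s _) (cong r eq)
    act (inj₂ (inj₂ refl)) = trans (s _) (cong r (trans (s _) (cong r eq)))
  ... | inj₂ (inj₂ eq) = inj₂ (inj₂ λ y~x → act (r-cover y~x))
    where
    act : ∀ {y} → y ≡ x ⊎ y ≡ r x ⊎ y ≡ r (r x) → app c y ≡ r (r y)
    act (inj₁ refl)        = eq
    act (inj₂ (inj₁ refl)) = trans (s _) (cong r eq)
    act (inj₂ (inj₂ refl)) = trans (s _) (cong r (trans (s _) (cong r eq)))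

  rr-~ : ∀ x → r (r x) ~ x
  rr-~ x = trans (r-~ (r x)) (r-~ x)

  c³ : ∀ {c} → C c → ∀ x → app c (app c (app c x)) ≡ x
  c³ {c} Cc x with C-acts {c} Cc x
  ... | inj₁ act = trans (cong (λ y → app c (app c y)) (act refl)) (trans (cong (app c) (act refl)) (act refl))
  ... | inj₂ (inj₁ act) = trans (cong (λ y → app c (app c y)) (act refl))
          (trans (cong (app c) (act (r-~ x))) (trans (act (rr-~ x)) (r³ x)))
  ... | inj₂ (inj₂ act) = trans (cong (λ y → app c (app c y)) (act refl))
          (trans (cong (app c) (trans (act (rr-~ x)) (cong r (r³ x)))) (trans (act (r-~ x)) (r³ x)))

  -- Elsewhere `k` may be odd, but its square is in `C`. On the block of `x`, `k` is a nontrivial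
  -- power of `r`, and so is the square.
  even-moves⇒C-moves : ∀ {k x} → K k → Parity k x false → app k x ≢ x → ∃ λ c → C c × app c x ≢ x
  even-moves⇒C-moves {k} {x} Kk h kx≢x = k · k , square-∈C {k} Kk , moved (r-cover (proj₂ Kk x))
    where
    moved : app k x ≡ x ⊎ app k x ≡ r x ⊎ app k x ≡ r (r x) → app k (app k x) ≢ x
    moved (inj₁ eq) _         = kx≢x eq
    moved (inj₂ (inj₁ eq)) kk = rr-≢ x (trans (sym (trans (cong (app k) eq) (trans h (cong r eq)))) kk)
    moved (inj₂ (inj₂ eq)) kk = r-≢ x (trans (sym (trans (cong (app k) eq)
      (trans (parity-rot {k} (proj₁ Kk) false true h) (trans (cong (rot true) eq) (cong r (r³ x)))))) kk)

  -- Elements `k` and `l` of `K` take `x` to the two other points of its block. If neither is even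
  -- there, their product is, and it still moves `x`.
  C-moves : ∀ x → ∃ λ c → C c × app c x ≢ x
  C-moves x with K-transitive-on-block (sym (r-~ x)) | K-transitive-on-block (sym (rr-~ x))
  ... | k , Kk , kx | l , Kl , lx = pick (parity (proj₁ Kk) x) (parity (proj₁ Kl) x)
    where
    pick : (∃ λ σ → Parity k x σ) → (∃ λ σ → Parity l x σ) → ∃ λ c → C c × app c x ≢ x
    pick (false , h) _ = even-moves⇒C-moves {k} Kk h (λ eq → r-≢ x (trans (sym kx) eq))
    pick (true , _) (false , h′) = even-moves⇒C-moves {l} Kl h′ (λ eq → rr-≢ x (trans (sym lx) eq))
    pick (true , h) (true , h′) = even-moves⇒C-moves {k · l} (K-· {k} {l} Kk Kl)
      (parity-· {k} {l} (proj₁ Kk) true true (parity-block {k} (proj₁ Kk) true (proj₂ Kl x) h) h′)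
      (λ eq → rr-≢ x (trans (sym (trans (cong (app k) lx)
        (trans (parity-rot {k} (proj₁ Kk) true true h) (cong r kx)))) eq))

  -- On a block, k centralises C if it is even there, and inverts C if it is odd there.
  conj-even : ∀ {c k x} → C c → K k → Parity k x false → app k (app c x) ≡ app c (app k x)
  conj-even {c} {k} {x} Cc (Gk , k~) h with C-acts {c} Cc x
  ... | inj₁ act        = trans (cong (app k) (act refl)) (sym (act (k~ x)))
  ... | inj₂ (inj₁ act) = trans (cong (app k) (act refl)) (trans h (sym (act (k~ x))))
  ... | inj₂ (inj₂ act) = trans (cong (app k) (act refl))
          (trans (parity-rot {k} Gk false true h) (sym (act (k~ x))))

  conj-odd : ∀ {c k x} → C c → K k → Parity k x true → app c (app k (app c x)) ≡ app k x
  conj-odd {c} {k} {x} Cc (Gk , k~) h with C-acts {c} Cc x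
  ... | inj₁ act        = trans (cong (λ y → app c (app k y)) (act refl)) (act (k~ x))
  ... | inj₂ (inj₁ act) = trans (cong (λ y → app c (app k y)) (act refl)) (trans (cong (app c) h)
          (trans (act (trans (rr-~ _) (k~ x))) (r³ _)))
  ... | inj₂ (inj₂ act) = trans (cong (λ y → app c (app k y)) (act refl))
          (trans (cong (app c) (parity-rot {k} Gk true true h))
          (trans (act (trans (r-~ _) (k~ x))) (r³ _)))

  -- Separation of blocks and the constant sign on `K`

  parity-⁻¹ : ∀ {g x} → G g → ∀ σ → Parity g x σ → Parity (g ⁻¹) (app g x) σ
  parity-⁻¹ {g} {x} Gg false h = trans (cong (app (g ⁻¹)) (sym h))
    (trans (⁻¹-cancelˡ g _) (cong r (sym (⁻¹-cancelˡ g x))))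
  parity-⁻¹ {g} {x} Gg true  h =
    trans (cong (app (g ⁻¹)) (sym (parity-rot {g} Gg true true h)))
          (trans (⁻¹-cancelˡ g _) (cong (λ y → r (r y)) (sym (⁻¹-cancelˡ g x))))

  xor-conj : ∀ σ τ → (τ xor σ) xor τ ≡ σ
  xor-conj false false = refl
  xor-conj false true  = refl
  xor-conj true  false = refl
  xor-conj true  true  = refl

  -- The parity of `g` enters twice, through `g` and through its inverse, and cancels.
  parity-conj : ∀ {g k x} → G g → K k → ∀ σ → Parity k x σ →
                Parity ((g · k) · (g ⁻¹)) (app g x) σ
  parity-conj {g} {k} {x} Gg (Gk , k~) σ h with parity Gg x
  ... | τ , hg = subst (Parity ((g · k) · (g ⁻¹)) (app g x)) (xor-conj σ τ)
    (parity-· {g · k} {g ⁻¹} (G-mul Gg Gk) (τ xor σ) τ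
      (subst (λ y → Parity (g · k) y (τ xor σ)) (sym (⁻¹-cancelˡ g x))
        (parity-· {g} {k} Gg τ σ (parity-block {g} Gg τ (k~ x) hg) h))
      (parity-⁻¹ {g} Gg τ hg))

  C-conj : ∀ {g c} → G g → C c → C ((g · c) · (g ⁻¹))
  C-conj {g} {c} Gg (Kc , s) = K-conj {g} {c} Gg Kc , λ x →
    subst (λ y → Parity ((g · c) · (g ⁻¹)) y false) (⁻¹-cancelʳ g x)
      (parity-conj {g} {c} Gg Kc false (s _))

  -- Multiplying `c` by a conjugate under `k` of a power of `c` can cancel it at `y` but not at `x`,
  -- as `k` centralises on one of the two blocks and inverts on the other.
  kill : ∀ {c k x y} → C c → K k → ∀ σ → Parity k x σ → Parity k y (not σ) →
         ∃ λ c′ → C c′ × (app c x ≢ x → app c′ x ≢ x) × app c′ y ≡ y ×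
                  (∀ z → app c z ≡ z → app c′ z ≡ z)
  kill {c} {k} {x} {y} Cc Kk@(Gk , _) false hx hy =
      -- This acts as the square of `c` on the block of `x` and trivially on that of `y`.
      c · ((k · c) · (k ⁻¹)) , C-· {c} {(k · c) · (k ⁻¹)} Cc (C-conj {k} {c} Gk Cc)
    , (λ cx≢x eq → cx≢x (trans (cong (app c) (sym (trans (sym at-x) eq))) (c³ {c} Cc x)))
    , trans (conj-odd {c} {k} Cc Kk (parity-block {k} Gk true (k⁻¹~ y) hy)) (⁻¹-cancelʳ k y)
    , λ z cz → trans (cong (λ w → app c (app k w)) (C-fixes-block {c} Cc (k⁻¹~ z) cz))
        (trans (cong (app c) (⁻¹-cancelʳ k z)) cz)
    where
    k⁻¹~ : ∀ z → app (k ⁻¹) z ~ z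
    k⁻¹~ = proj₂ (K-⁻¹ {k} Kk)
    at-x : app c (app k (app c (app (k ⁻¹) x))) ≡ app c (app c x)
    at-x = cong (app c) (trans (conj-even {c} {k} Cc Kk (parity-block {k} Gk false (k⁻¹~ x) hx))
      (cong (app c) (⁻¹-cancelʳ k x)))
  kill {c} {k} {x} {y} Cc Kk@(Gk , _) true hx hy =
      -- Now `k` inverts at `x` and centralises at `y`. Conjugating the square leaves the inverse of
      -- `c` at `x` and the cube of `c`, which is trivial, at `y`.
      c · ((k · (c · c)) · (k ⁻¹)) , C-· {c} {(k · (c · c)) · (k ⁻¹)} Cc (C-conj {k} {c · c} Gk CC)
    , (λ cx≢x eq → cx≢x (trans (cong (app c) (sym eq)) at-x))
    , trans (cong (app c) (trans (conj-even {c · c} {k} CC Kk (parity-block {k} Gk false (k⁻¹~ y) hy))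
        (cong (app (c · c)) (⁻¹-cancelʳ k y)))) (c³ {c} Cc y)
    , λ z cz → trans (cong (λ w → app c (app k w)) (C-fixes-block {c · c} CC (k⁻¹~ z) (trans (cong (app c) cz) cz)))
        (trans (cong (app c) (⁻¹-cancelʳ k z)) cz)
    where
    CC : C (c · c)
    CC = C-· {c} {c} Cc Cc
    k⁻¹~ : ∀ z → app (k ⁻¹) z ~ z
    k⁻¹~ = proj₂ (K-⁻¹ {k} Kk)
    at-x : app c (app c (app k (app c (app c (app (k ⁻¹) x))))) ≡ x
    at-x = trans (conj-odd {c · c} {k} CC Kk (parity-block {k} Gk true (k⁻¹~ x) hx)) (⁻¹-cancelʳ k x)

  SeparatingParity : Set
  SeparatingParity = ∀ {x y} → ¬ (x ~ y) → ∃ λ k → ∃ λ σ → K k × Parity k x σ × Parity k y (not σ)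

  -- `kill` is applied for every point outside the block of `x`; points fixed earlier stay fixed.
  isolate : SeparatingParity → ∀ x → ∃ λ c → (C c × app c x ≢ x) × (∀ y → y ~ x ⊎ app c y ≡ y)
  isolate sep x = extend-all (λ c y → y ~ x ⊎ app c y ≡ y) (C-moves x) step
    where
    step : ∀ c y → C c × app c x ≢ x → ∃ λ c′ → (C c′ × app c′ x ≢ x) × (y ~ x ⊎ app c′ y ≡ y) ×
           (∀ z → z ~ x ⊎ app c z ≡ z → z ~ x ⊎ app c′ z ≡ z)
    step c y (Cc , cx≢x) with blk y Fin.≟ blk x
    ... | yes y~x = c , (Cc , cx≢x) , inj₁ y~x , λ _ q → q
    ... | no  y≁x with sep (λ x~y → y≁x (sym x~y))
    ... | k , σ , Kk , hx , hy with kill {c} {k} Cc Kk σ hx hy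
    ... | c′ , Cc′ , moves , fixed , still = c′ , (Cc′ , moves cx≢x) , inj₂ fixed , λ where
          z (inj₁ z~x) → inj₁ z~x
          z (inj₂ cz)  → inj₂ (still z cz)

  -- Starting from the identity, each fixed point `y` met is repaired by an element supported on its
  -- block. The current `c` fixes that whole block, so points already moved are not affected.
  derangement : SeparatingParity → ∃ λ c → C c × (∀ y → app c y ≢ y)
  derangement sep = extend-all (λ c y → app c y ≢ y) (e , ((G-e , λ _ → refl) , λ _ → refl)) step
    where
    step : ∀ c y → C c → ∃ λ c′ → C c′ × app c′ y ≢ y × (∀ z → app c z ≢ z → app c′ z ≢ z)
    step c y Cc with app c y Fin.≟ y
    ... | no  cy≢y = c , Cc , cy≢y , λ _ q → q
    ... | yes cy≡y with isolate sep y
    ... | c₁ , (Cc₁ , moves) , supp = c₁ · c , C-· {c₁} {c} Cc₁ Cc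
        , (λ eq → moves (trans (cong (app c₁) (sym cy≡y)) eq))
        , λ z cz≢z eq → still z cz≢z eq (supp (app c z))
      where
      still : ∀ z → app c z ≢ z → app c₁ (app c z) ≡ z → app c z ~ y ⊎ app c₁ (app c z) ≡ app c z → _
      still z cz≢z eq (inj₁ cz~y) = cz≢z (C-fixes-block {c} Cc (trans (sym (proj₂ (proj₁ Cc) z)) cz~y) cy≡y)
      still z cz≢z eq (inj₂ fix)  = cz≢z (trans (sym fix) eq)

  SameParity : Ω → Ω → Set
  SameParity x y = ∀ k → K k → ∀ σ → Parity k x σ → Parity k y σ

  -- The parity of `k` at `app g x` is that of its conjugate by the inverse of `g` at `x`, and this
  -- conjugate is again in `K`.
  sameParity-invariant : InvariantPartition G SameParity
  sameParity-invariant =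
      record { refl = λ _ _ _ h → h
             ; sym = λ {x} {y} R k Kk σ h → let τ , h′ = parity (proj₁ Kk) x in
                 subst (Parity k x) (parity-unique {k} {y} τ σ (R k Kk τ h′) h) h′
             ; trans = λ R S k Kk σ h → S k Kk σ (R k Kk σ h) }
    , λ g Gg x y R k Kk σ h →
        let k′ = ((g ⁻¹) · k) · g
            Kk′ = K-conj {g ⁻¹} {k} (G-inv Gg) Kk
            τ , h′ = parity (proj₁ Kk) (app g y)
            atx = subst (λ z → Parity k′ z σ) (⁻¹-cancelˡ g x) (parity-conj {g ⁻¹} {k} (G-inv Gg) Kk σ h)
            aty = subst (λ z → Parity k′ z τ) (⁻¹-cancelˡ g y) (parity-conj {g ⁻¹} {k} (G-inv Gg) Kk τ h′)
        in subst (Parity k (app g y)) (parity-unique {k′} {y} τ σ aty (R k′ Kk′ σ atx)) h′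

  ≡-or-not : ∀ σ τ → τ ≡ σ ⊎ τ ≡ not σ
  ≡-or-not false false = inj₁ refl
  ≡-or-not false true  = inj₂ refl
  ≡-or-not true  false = inj₂ refl
  ≡-or-not true  true  = inj₁ refl

  opaque
    -- `SameParity` is coarser than the block relation. If it is total, signs are constant; if it is
    -- the block relation, distinct blocks can be separated and `K` contains a derangement.
    K-sign : ∀ {k} → K k → ∃ λ σ → Sign k σ
    K-sign {k} Kk with coarser SameParity sameParity-invariant
      (λ x~y k Kk σ h → parity-block {k} (proj₁ Kk) σ (sym x~y) h)
    ... | inj₁ total = let σ , h = parity (proj₁ Kk) (base zero) in σ , λ x → total (base zero) x k Kk σ h
    ... | inj₂ R⊆~ = let c , Cc , moves = derangement sep ; x , cx≡x = K-fixes-point c (proj₁ Cc) in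
            contradiction cx≡x (moves x)
      where
      sep : SeparatingParity
      sep {x} {y} x≁y = by-contradiction λ none → x≁y (R⊆~ x y λ k Kk σ h →
        let τ , h′ = parity (proj₁ Kk) y in
        [ (λ τ≡σ → subst (Parity k y) τ≡σ h′)
        , (λ τ≡¬σ → contradiction (k , σ , Kk , h , subst (Parity k y) τ≡¬σ h′) none) ]′ (≡-or-not σ τ))


  -- The constant sign on `G`

  p-odd : ∃ λ q → p ≡ 1 + q * 2
  p-odd with p % 2 in rem | m≡m%n+[m/n]*n p 2 | m%n<n p 2
  ... | 0 | _  | _ with prime⇒irreducible p-prime (m%n≡0⇒n∣m p 2 rem)
  ...   | inj₁ ()
  ...   | inj₂ refl = contradiction 5≤p λ { (s≤s (s≤s ())) }
  p-odd | 1 | eq | _ = p / 2 , eq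
  p-odd | suc (suc _) | _ | s≤s (s≤s ())

  a^-sign : ∀ m → Sign (a^ m) false
  a^-sign zero    x = refl
  a^-sign (suc m) x = trans (cong (app a) (a^-sign m x)) (sym (r-a _))

  -- γ a = a^τ γ k with k in K, so parity of γ changes by the sign of k along each step of a;
  -- as p is odd, that sign must be even.
  opaque
    G-sign : ∀ {γ} → G γ → ∃ λ σ → Sign γ σ
    G-sign {γ} Gγ with G-twist Gγ
    ... | τ , tw with K-quotient {a^ τ · γ} {γ · a} (G-mul (Ga^ τ) Gγ) (G-mul Gγ Ga) (λ x → sym (tw x))
    ... | Kk with K-sign {((a^ τ · γ) ⁻¹) · (γ · a)} Kk
    ... | ε , sk = proj₁ (parity Gγ (base zero)) , all
      where
      k : Perm (3 * p)
      k = ((a^ τ · γ) ⁻¹) · (γ · a)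
      step : ∀ σ {x} → Parity γ x σ → Parity γ (app a x) (σ xor ε)
      step σ {x} h = begin
        app γ (r (app a x))                        ≡⟨ cong (app γ) (r-a x) ⟩
        app γ (app a (r x))                        ≡⟨ ⁻¹-cancelʳ (a^ τ · γ) _ ⟨
        app ((a^ τ · γ) · k) (r x)                 ≡⟨ parity-· {a^ τ · γ} {k} (G-mul (Ga^ τ) Gγ) σ ε
                                                        (parity-· {a^ τ} {γ} (Ga^ τ) false σ (a^-sign τ _)
                                                          (parity-block {γ} Gγ σ (proj₂ Kk x) h)) (sk x) ⟩
        rot (σ xor ε) (app ((a^ τ · γ) · k) x)     ≡⟨ cong (rot (σ xor ε)) (⁻¹-cancelʳ (a^ τ · γ) _) ⟩
        rot (σ xor ε) (app γ (app a x))            ∎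
        where open ≡-Reasoning
      xor-twice : ∀ σ ε → (σ xor ε) xor ε ≡ σ
      xor-twice false false = refl
      xor-twice false true  = refl
      xor-twice true  false = refl
      xor-twice true  true  = refl
      steps : ∀ q σ {x} → Parity γ x σ → Parity γ (app (a^ (q * 2)) x) σ
      steps zero    σ     h = h
      steps (suc q) σ {x} h = subst (Parity γ (app a (app a (app (a^ (q * 2)) x)))) (xor-twice σ ε)
        (step (σ xor ε) (step σ (steps q σ h)))
      xor-cancel : ∀ σ ε → σ xor ε ≡ σ → ε ≡ false
      xor-cancel false false _ = refl
      xor-cancel true  false _ = refl
      -- Going round once takes `1 + q * 2` steps. The steps cancel in pairs, so the parity at the
      -- starting point changes by `ε` alone.
      ε≡false : ε ≡ false
      ε≡false = let σ , h = parity Gγ (base zero) ; q , p≡ = p-odd in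
        xor-cancel σ ε (parity-unique {γ} {base zero} (σ xor ε) σ
          (subst (λ y → Parity γ y (σ xor ε))
            (trans (cong (λ m → app (a^ m) (base zero)) (sym p≡)) (aᵖ≈e _))
            (step σ (steps q σ h))) h)
      along : ∀ m σ {x} → Parity γ x σ → Parity γ (app (a^ m) x) σ
      along zero    σ h = h
      along (suc m) σ h = subst (Parity γ _) (trans (cong (σ xor_) ε≡false) (xor-identityʳ σ))
        (step σ (along m σ h))
      all : Sign γ (proj₁ (parity Gγ (base zero)))
      all y = let σ , h = parity Gγ (base zero) ; m , y~ = a-transitive-on-blocks (base zero) y in
        parity-block {γ} Gγ σ y~ (along m σ h)

  parity-resp : ∀ {g h x} σ → g ≈ h → Parity g x σ → Parity h x σ
  parity-resp {x = x} σ g≈h p = trans (sym (g≈h _)) (trans p (cong (rot σ) (g≈h x)))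

  C-resp : ∀ {g h} → g ≈ h → C g → C h
  C-resp {g} {h} g≈h ((Gg , g~) , s) =
    (G-resp g≈h Gg , λ x → trans (cong blk (sym (g≈h x))) (g~ x)) ,
    λ x → parity-resp {g} {h} false g≈h (s x)

  sign-⁻¹ : ∀ {g} → G g → ∀ σ → Sign g σ → Sign (g ⁻¹) σ
  sign-⁻¹ {g} Gg σ s x = subst (λ y → Parity (g ⁻¹) y σ) (⁻¹-cancelʳ g x) (parity-⁻¹ {g} Gg σ (s _))

  C-⁻¹ : ∀ {g} → C g → C (g ⁻¹)
  C-⁻¹ {g} (Kg , s) = K-⁻¹ {g} Kg , sign-⁻¹ {g} (proj₁ Kg) false s

  C-quotient : ∀ {g h} → G g → G h → ∀ σ → Sign g σ → Sign h σ → g ∼ h → C ((g ⁻¹) · h)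
  C-quotient {g} {h} Gg Gh σ sg sh g∼h = K-quotient {g} {h} Gg Gh g∼h , λ x →
    subst (Parity ((g ⁻¹) · h) x) (xor-same σ)
      (parity-· {g ⁻¹} {h} (G-inv Gg) σ σ (sign-⁻¹ {g} Gg σ sg _) (sh x))

  opaque
    -- An element of `C` moving `x` acts on its block as a 3-cycle, so its powers reach every point
    -- there.
    C-transitive-on-block : ∀ {x y} → y ~ x → ∃ λ c → C c × app c x ≡ y
    C-transitive-on-block {x} {y} y~x with C-moves x
    ... | c , Cc , cx≢x = find (C-acts {c} Cc x) (r-cover y~x)
      where
      find : (∀ {y} → y ~ x → app c y ≡ y) ⊎ (∀ {y} → y ~ x → app c y ≡ r y) ⊎
             (∀ {y} → y ~ x → app c y ≡ r (r y)) →
             y ≡ x ⊎ y ≡ r x ⊎ y ≡ r (r x) → ∃ λ c → C c × app c x ≡ y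
      find _ (inj₁ y≡x) = e , ((G-e , λ _ → refl) , λ _ → refl) , sym y≡x
      find (inj₁ act) (inj₂ _) = contradiction (act refl) cx≢x
      find (inj₂ (inj₁ act)) (inj₂ (inj₁ eq)) = c , Cc , trans (act refl) (sym eq)
      find (inj₂ (inj₁ act)) (inj₂ (inj₂ eq)) = c · c , C-· {c} {c} Cc Cc ,
        trans (cong (app c) (act refl)) (trans (act (r-~ x)) (sym eq))
      find (inj₂ (inj₂ act)) (inj₂ (inj₂ eq)) = c , Cc , trans (act refl) (sym eq)
      find (inj₂ (inj₂ act)) (inj₂ (inj₁ eq)) = c · c , C-· {c} {c} Cc Cc ,
        trans (cong (app c) (act refl)) (trans (act (rr-~ x)) (trans (cong r (r³ x)) (sym eq)))

  -- An even element of `K` has trivial cube, so it cannot be an involution.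
  involution⇒odd : (∃ λ k → K k × ¬ (k ≈ e) × ((k · k) ≈ e)) → ∃ λ k → K k × Sign k true
  involution⇒odd (k , Kk , k≉e , kk≈e) with K-sign {k} Kk
  ... | true  , s = k , Kk , s
  ... | false , s = contradiction (λ x → trans (sym (kk≈e _)) (c³ {k} (Kk , s) x)) k≉e

  -- Orders of `C`, `K` and the stabilisers

  point : Ω → Fin 3 → Ω
  point x zero             = x
  point x (suc zero)       = r x
  point x (suc (suc zero)) = r (r x)

  point-~ : ∀ x u → point x u ~ x
  point-~ x zero             = refl
  point-~ x (suc zero)       = r-~ x
  point-~ x (suc (suc zero)) = rr-~ x

  point-injective : ∀ x u v → point x u ≡ point x v → u ≡ v
  point-injective x zero             zero             _  = refl
  point-injective x zero             (suc zero)       eq = contradiction (sym eq) (r-≢ x)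
  point-injective x zero             (suc (suc zero)) eq = contradiction (sym eq) (rr-≢ x)
  point-injective x (suc zero)       zero             eq = contradiction eq (r-≢ x)
  point-injective x (suc zero)       (suc zero)       _  = refl
  point-injective x (suc zero)       (suc (suc zero)) eq = contradiction (sym eq) (r-≢ (r x))
  point-injective x (suc (suc zero)) zero             eq = contradiction eq (rr-≢ x)
  point-injective x (suc (suc zero)) (suc zero)       eq = contradiction eq (r-≢ (r x))
  point-injective x (suc (suc zero)) (suc (suc zero)) _  = refl

  point-cover : ∀ {x y} → y ~ x → ∃ λ u → y ≡ point x u
  point-cover y~x with r-cover y~x
  ... | inj₁ eq        = zero , eq
  ... | inj₂ (inj₁ eq) = suc zero , eq
  ... | inj₂ (inj₂ eq) = suc (suc zero) , eq

  -- The orbit of `ω` under `P` is its block, which gives index three. Applied to `C` and to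
  -- `BlockStab`.
  orbit-stabiliser : ∀ ω (P : Perm (3 * p) → Set) →
    (∀ {g h} → P g → P h → P (g · h)) → (∀ {g} → P g → P (g ⁻¹)) →
    (∀ {g} → P g → app g ω ~ ω) → (∀ {y} → y ~ ω → ∃ λ g → P g × app g ω ≡ y) →
    ∀ {m} → Card (λ g → P g × app g ω ≡ ω) m → Card P (3 * m)
  orbit-stabiliser ω P P-· P-⁻¹ P-~ P-trans M = card-cosets M rep
    (λ u q (Pq , _) → P-· {rep u} {q} (P-rep u) Pq)
    (λ g Pg → let u , gω = point-cover (P-~ {g} Pg) in
      u , P-· {rep u ⁻¹} {g} (P-⁻¹ {rep u} (P-rep u)) Pg ,
      trans (cong (app (rep u ⁻¹)) (trans gω (sym (rep-ω u)))) (⁻¹-cancelˡ (rep u) ω))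
    (λ u v q q′ (_ , qω) (_ , q′ω) eq → point-injective ω u v
      (trans (sym (rep-ω u)) (trans (cong (app (rep u)) (sym qω))
        (trans (eq ω) (trans (cong (app (rep v)) q′ω) (rep-ω v))))))
    where
    rep : Fin 3 → Perm (3 * p)
    rep u = proj₁ (P-trans (point-~ ω u))
    P-rep : ∀ u → P (rep u)
    P-rep u = proj₁ (proj₂ (P-trans (point-~ ω u)))
    rep-ω : ∀ u → app (rep u) ω ≡ point ω u
    rep-ω u = proj₂ (proj₂ (P-trans (point-~ ω u)))

  -- `C` is the kernel of the sign on `K`; the coset representatives are `e` and the odd element
  -- `k`.
  card-K : (∃ λ k → K k × Sign k true) → ∀ {m} → Card C m → Card K (2 * m)
  card-K (k , Kk , sk) M = card-cosets M rep
    (λ { zero q Cq → proj₁ (C-resp {q} {e · q} (λ _ → refl) Cq)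
       ; (suc zero) q Cq → K-· {k} {q} Kk (proj₁ Cq) })
    bwd uniq
    where
    rep : Fin 2 → Perm (3 * p)
    rep zero       = e
    rep (suc zero) = k
    bwd : ∀ g → K g → ∃ λ u → C ((rep u ⁻¹) · g)
    bwd g Kg with K-sign {g} Kg
    ... | false , s = zero , C-resp {g} {(e ⁻¹) · g} (λ _ → refl) (Kg , s)
    ... | true  , s = suc zero , K-· {k ⁻¹} {g} (K-⁻¹ {k} Kk) Kg , λ x →
            parity-· {k ⁻¹} {g} (G-inv (proj₁ Kk)) true true (sign-⁻¹ {k} (proj₁ Kk) true sk _) (s x)
    mixed : ∀ {q q′} → C q → C q′ → ¬ (q ≈ (k · q′))
    mixed {q} {q′} (_ , s) (_ , s′) eq with parity-unique {q} {base zero} false true (s (base zero))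
      (parity-resp {k · q′} {q} true (λ x → sym (eq x))
        (parity-· {k} {q′} (proj₁ Kk) true false (sk _) (s′ (base zero))))
    ... | ()
    uniq : ∀ u v q q′ → C q → C q′ → (rep u · q) ≈ (rep v · q′) → u ≡ v
    uniq zero       zero       q q′ Cq Cq′ eq = refl
    uniq zero       (suc zero) q q′ Cq Cq′ eq = contradiction eq (mixed {q} {q′} Cq Cq′)
    uniq (suc zero) zero       q q′ Cq Cq′ eq = contradiction (λ x → sym (eq x)) (mixed {q′} {q} Cq′ Cq)
    uniq (suc zero) (suc zero) q q′ Cq Cq′ eq = refl

  b^-fixes : ∀ j {x} → blk x ≡ i₀ → blk (app (b^ j) x) ≡ i₀
  b^-fixes zero    x∈i₀ = x∈i₀
  b^-fixes (suc j) x∈i₀ = b-fixes _ (b^-fixes j x∈i₀)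

  BlockStab : Ω → Perm (3 * p) → Set
  BlockStab ω g = G g × app g ω ~ ω

  -- Modulo `K` the stabiliser of the base block consists of the `d` powers of `b`. Conjugation by
  -- `τ` transports this to the block of `ω`.
  card-BlockStab : ∀ ω {m} → Card K m → Card (BlockStab ω) (d * m)
  card-BlockStab ω M with G-trans (base zero) ω
  ... | τ , Gτ , τ-base = card-cosets M rep fwd bwd uniq
    where
    rep : Fin d → Perm (3 * p)
    rep j = (τ · b^ (toℕ j)) · (τ ⁻¹)
    G-rep : ∀ j → G (rep j)
    G-rep j = G-mul (G-mul Gτ (Gb^ (toℕ j))) (G-inv Gτ)
    τ⁻¹ω : app (τ ⁻¹) ω ≡ base zero
    τ⁻¹ω = trans (cong (app (τ ⁻¹)) (sym τ-base)) (⁻¹-cancelˡ τ _)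
    bʲ-base : ∀ j → app (b^ j) (base zero) ~ base zero
    bʲ-base j = trans (b^-fixes j (blk-base zero)) (sym (blk-base zero))
    fwd : ∀ j q → K q → BlockStab ω (rep j · q)
    fwd j q (Gq , q~) = G-mul (G-rep j) Gq , trans (preserves-blocks (G-rep j) (q~ ω))
      (trans (cong (λ z → blk (app τ (app (b^ (toℕ j)) z))) τ⁻¹ω)
        (trans (preserves-blocks Gτ (bʲ-base (toℕ j))) (cong blk τ-base)))
    bwd : ∀ g → BlockStab ω g → ∃ λ j → K ((rep j ⁻¹) · g)
    bwd g (Gg , gω~ω) with normal-form {((τ ⁻¹) · g) · τ} (G-mul (G-mul (G-inv Gτ) Gg) Gτ)
    ... | s , j , h∼ = j , K-quotient {rep j} {g} (G-rep j) Gg λ x →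
        trans (preserves-blocks Gτ (sym (h∼b (app (τ ⁻¹) x))))
          (cong blk (trans (⁻¹-cancelʳ τ _) (cong (app g) (⁻¹-cancelʳ τ x))))
      where
      open ≡-Reasoning
      h = ((τ ⁻¹) · g) · τ
      -- The conjugate `h` and the powers of `b` fix the base block, so `a^ s` fixes it too and is
      -- trivial.
      aˢ-base : app (a^ s) (base zero) ~ app (a^ 0) (base zero)
      aˢ-base = begin
        blk (app (a^ s) (base zero))                       ≡⟨ preserves-blocks (Ga^ s) (bʲ-base (toℕ j)) ⟨
        blk (app (a^ s) (app (b^ (toℕ j)) (base zero)))    ≡⟨ h∼ (base zero) ⟨
        blk (app (τ ⁻¹) (app g (app τ (base zero))))       ≡⟨ cong (λ z → blk (app (τ ⁻¹) (app g z))) τ-base ⟩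
        blk (app (τ ⁻¹) (app g ω))                         ≡⟨ preserves-blocks (G-inv Gτ) gω~ω ⟩
        blk (app (τ ⁻¹) ω)                                 ≡⟨ cong blk τ⁻¹ω ⟩
        blk (base zero)                                    ∎
      h∼b : h ∼ b^ (toℕ j)
      h∼b x = trans (h∼ x) (cong blk (a^-determined s 0 aˢ-base _))
    uniq : ∀ u v q q′ → K q → K q′ → (rep u · q) ≈ (rep v · q′) → u ≡ v
    uniq u v q q′ (Gq , q~) (Gq′ , q′~) eq = b^-injective u v λ x → reflects-blocks Gτ (begin
      blk (app τ (app (b^ (toℕ u)) x))           ≡⟨ cong (λ z → blk (app τ (app (b^ (toℕ u)) z))) (⁻¹-cancelˡ τ x) ⟨
      blk (app (rep u) (app τ x))                  ≡⟨ preserves-blocks (G-rep u) (q~ _) ⟨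
      blk (app (rep u) (app q (app τ x)))          ≡⟨ cong blk (eq (app τ x)) ⟩
      blk (app (rep v) (app q′ (app τ x)))         ≡⟨ preserves-blocks (G-rep v) (q′~ _) ⟩
      blk (app (rep v) (app τ x))                  ≡⟨ cong (λ z → blk (app τ (app (b^ (toℕ v)) z))) (⁻¹-cancelˡ τ x) ⟩
      blk (app τ (app (b^ (toℕ v)) x))           ∎)
      where open ≡-Reasoning

  -- Covering intersecting families by translates of a stabiliser in `C`

  module Stabiliser
    (odd : ∃ λ k → K k × Sign k true) (ω : Ω) (L : List (Perm (3 * p)))
    (L-enumerates : EnumeratesStabiliser G ω L) where

    Cω : Perm (3 * p) → Set
    Cω g = C g × app g ω ≡ ω

    -- `G` is an arbitrary predicate, so filtering the list `L` relies on the excluded middle of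
    -- `lem`.
    Cω? : ∀ g → Dec (Cω g)
    Cω? g = lem (Cω g)

    n : ℕ
    n = length (filter Cω? L)

    card-Cω : Card Cω n
    card-Cω = fromList (filter Cω? L) (All.all-filter Cω? L)
      (AllPairs.filter⁺ Cω? (proj₁ (proj₂ L-enumerates))) complete
      where
      complete : ∀ g → Cω g → Any (g ≈_) (filter Cω? L)
      complete g (Cg , gω) with proj₂ (proj₂ L-enumerates) g (C⊆G {g} Cg) gω
      ... | g∈L with Any.filter⁺ Cω? g∈L
      ... | inj₁ g∈ = g∈
      ... | inj₂ ∉C = contradiction
              (C-resp {g} g≈ Cg , trans (sym (g≈ ω)) gω) ∉C
        where
        g≈ : g ≈ Any.lookup g∈L
        g≈ = Any.lookup-result g∈L

    card-C : Card C (3 * n)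
    card-C = orbit-stabiliser ω C (λ {g} {h} → C-· {g} {h}) (λ {g} → C-⁻¹ {g})
      (λ Cg → proj₂ (proj₁ Cg) ω) C-transitive-on-block card-Cω

    card-K′ : Card K (2 * (3 * n))
    card-K′ = card-K odd card-C

    -- The block stabiliser is counted once through the point stabiliser and once through `K`.
    length-L : 3 * length L ≡ d * (2 * (3 * n))
    length-L = Card-unique from-L (card-BlockStab ω card-K′)
      where
      card-L : Card (λ g → BlockStab ω g × app g ω ≡ ω) (length L)
      card-L = fromList L
        (All.map (λ { (Gg , gω) → (Gg , cong blk gω) , gω }) (proj₁ L-enumerates))
        (proj₁ (proj₂ L-enumerates))
        (λ { g ((Gg , _) , gω) → proj₂ (proj₂ L-enumerates) g Gg gω })
      from-L : Card (BlockStab ω) (3 * length L)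
      from-L = orbit-stabiliser ω (BlockStab ω)
        (λ { {g} {h} (Gg , g~) (Gh , h~) → G-mul Gg Gh , trans (preserves-blocks Gg h~) g~ })
        (λ { {g} (Gg , g~) → G-inv Gg , trans (preserves-blocks (G-inv Gg) (sym g~)) (cong blk (⁻¹-cancelˡ g ω)) })
        proj₂
        (λ y~ω → let k , (Gk , k~) , kω = K-transitive-on-block (sym y~ω) in k , (Gk , k~ ω) , kω)
        card-L

    -- `X` lies in a union of `m` two-sided translates of `Cω`, so by `card-bound` a list of
    -- distinct elements of `X` has length at most `m * n`.
    Cover : ℕ → (Perm (3 * p) → Set) → Set
    Cover m X = Σ (Fin m → Perm (3 * p)) λ σ → Σ (Fin m → Perm (3 * p)) λ π →
                ∀ g → X g → ∃ λ j → Cω ((σ j · g) · π j)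

    cover-∪ : ∀ {m k X Y} → Cover m X → Cover k Y → Cover (m + k) (λ g → X g ⊎ Y g)
    cover-∪ {m} {k} {X} {Y} (σ , π , cov) (σ′ , π′ , cov′) =
      [ σ , σ′ ]′ ∘ splitAt m , [ π , π′ ]′ ∘ splitAt m , both
      where
      both : ∀ g → X g ⊎ Y g → ∃ λ j → Cω (([ σ , σ′ ]′ (splitAt m j) · g) · [ π , π′ ]′ (splitAt m j))
      both g (inj₁ Xg) with cov g Xg
      ... | j , c = j ↑ˡ k , subst (λ s → Cω (([ σ , σ′ ]′ s · g) · [ π , π′ ]′ s))
                              (sym (Fin.splitAt-↑ˡ m j k)) c
      both g (inj₂ Yg) with cov′ g Yg
      ... | j , c = m ↑ʳ j , subst (λ s → Cω (([ σ , σ′ ]′ s · g) · [ π , π′ ]′ s))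
                              (sym (Fin.splitAt-↑ʳ m k j)) c

    cover-≤ : ∀ {m l X} → m ≤ l → Cover m X → Cover l X
    cover-≤ {m} {X = X} m≤l cov with ℕ.m≤n⇒∃[o]m+o≡n m≤l
    -- The `k` surplus pieces cover the empty set, with `e` as a dummy translate.
    ... | k , refl with cover-∪ {m} {k} {X} {λ _ → ⊥} cov ((λ _ → e) , (λ _ → e) , λ _ ())
    ... | σ , π , cov′ = σ , π , λ g Xg → cov′ g (inj₁ Xg)

    module _ (X : Perm (3 * p) → Set) (X⊆G : ∀ {g} → X g → G g)
      (X-intersecting : ∀ {g h} → X g → X h → ∃ λ x → app g x ≡ app h x)
      (ς : Bool) (X-sign : ∀ {g} → X g → Sign g ς) where

      -- All signs being equal, dividing by `g₀` puts `X` inside `C`, which splits into three cosets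
      -- of `Cω` according to the image of `ω`.
      cover-coset : (∀ g h → X g → X h → g ∼ h) → Cover 3 X
      cover-coset same with lem (∃ X)
      ... | no ¬∃ = (λ _ → e) , (λ _ → e) , λ g Xg → contradiction (g , Xg) ¬∃
      ... | yes (g₀ , Xg₀) = σ , (λ _ → e) , cov
        where
        c : Fin 3 → Perm (3 * p)
        c u = proj₁ (C-transitive-on-block (point-~ ω u))
        Cc : ∀ u → C (c u)
        Cc u = proj₁ (proj₂ (C-transitive-on-block (point-~ ω u)))
        c-ω : ∀ u → app (c u) ω ≡ point ω u
        c-ω u = proj₂ (proj₂ (C-transitive-on-block (point-~ ω u)))
        σ : Fin 3 → Perm (3 * p)
        σ u = (c u ⁻¹) · (g₀ ⁻¹)
        cov : ∀ g → X g → ∃ λ j → Cω ((σ j · g) · e)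
        cov g Xg with C-quotient {g₀} {g} (X⊆G Xg₀) (X⊆G Xg) ς (X-sign Xg₀) (X-sign Xg) (same g₀ g Xg₀ Xg)
        ... | Cq with point-cover (proj₂ (proj₁ Cq) ω)
        ... | u , qω = u ,
          C-resp {(c u ⁻¹) · ((g₀ ⁻¹) · g)} {(σ u · g) · e} (λ _ → refl)
            (C-· {c u ⁻¹} {(g₀ ⁻¹) · g} (C-⁻¹ {c u} (Cc u)) Cq) ,
          trans (cong (app (c u ⁻¹)) (trans qω (sym (c-ω u)))) (⁻¹-cancelˡ (c u) ω)

      Label : Perm (3 * p) → Fin d → Set
      Label g j = ∃ λ s → g ∼ (a^ s · b^ (toℕ j))

      -- Elements with the same label lie in one coset of K; each meets h, from another coset,
      -- and by fixes-two-blocks always in the same block. Being of the same sign as h,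
      -- they agree with h, hence with each other, on that whole block.
      cover-label : ∀ {g₀ h} j → X g₀ → X h → Label g₀ j → ¬ (g₀ ∼ h) →
                    ∃ λ σ → ∃ λ π → ∀ g → X g → Label g j → Cω ((σ · g) · π)
      cover-label {g₀} {h} j Xg₀ Xh (s₀ , g₀∼) g₀≁h with X-intersecting Xg₀ Xh
      -- All elements with label `j` will agree at `x₀`. Conjugation by `τ` takes the stabiliser of
      -- `x₀` to that of `ω`.
      ... | x₀ , g₀x₀≡hx₀ with G-trans x₀ ω
      ... | τ , Gτ , τx₀≡ω = τ · (g₀ ⁻¹) , τ ⁻¹ , cov
        where
        cov : ∀ g → X g → Label g j → Cω (((τ · (g₀ ⁻¹)) · g) · (τ ⁻¹))
        cov g Xg (s , g∼) with X-intersecting Xg₀ Xg | X-intersecting Xg Xh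
        ... | y , g₀y≡gy | x , gx≡hx =
            C-resp {(τ · ((g₀ ⁻¹) · g)) · (τ ⁻¹)} {((τ · (g₀ ⁻¹)) · g) · (τ ⁻¹)} (λ _ → refl)
              (C-conj {τ} {(g₀ ⁻¹) · g} Gτ
                (C-quotient {g₀} {g} (X⊆G Xg₀) (X⊆G Xg) ς (X-sign Xg₀) (X-sign Xg) g₀∼g))
          , trans (cong (λ z → app τ (app (g₀ ⁻¹) (app g z))) τ⁻¹ω≡x₀)
              (trans (cong (app τ) (trans (cong (app (g₀ ⁻¹)) (trans gx₀≡hx₀ (sym g₀x₀≡hx₀)))
                (⁻¹-cancelˡ g₀ x₀))) τx₀≡ω)
          where
          g₀∼g : g₀ ∼ g
          g₀∼g = same-label-agree {g₀} {g} s₀ s (toℕ j) g₀∼ g∼ (cong blk g₀y≡gy)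
          τ⁻¹ω≡x₀ : app (τ ⁻¹) ω ≡ x₀
          τ⁻¹ω≡x₀ = trans (cong (app (τ ⁻¹)) (sym τx₀≡ω)) (⁻¹-cancelˡ τ x₀)
          fixes-x : app (g₀ ⁻¹) (app h x) ~ x
          fixes-x = trans (cong (λ z → blk (app (g₀ ⁻¹) z)) (sym gx≡hx))
            (trans (preserves-blocks (G-inv (X⊆G Xg₀)) (sym (g₀∼g x))) (cong blk (⁻¹-cancelˡ g₀ x)))
          fixes-x₀ : app (g₀ ⁻¹) (app h x₀) ~ x₀
          fixes-x₀ = cong blk (trans (cong (app (g₀ ⁻¹)) (sym g₀x₀≡hx₀)) (⁻¹-cancelˡ g₀ x₀))
          -- The quotient of `h` by `g₀` is not in `K` and fixes the blocks of `x₀` and `x`, so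
          -- these coincide.
          x₀~x : x₀ ~ x
          x₀~x = by-contradiction λ x₀≁x → g₀≁h λ z → sym
            (trans (cong blk (sym (⁻¹-cancelʳ g₀ (app h z))))
              (preserves-blocks (X⊆G Xg₀)
                (fixes-two-blocks {(g₀ ⁻¹) · h} (G-mul (G-inv (X⊆G Xg₀)) (X⊆G Xh)) fixes-x₀ fixes-x x₀≁x z)))
          even : Parity ((g ⁻¹) · h) x false
          even = subst (Parity ((g ⁻¹) · h) x) (xor-same ς)
            (parity-· {g ⁻¹} {h} (G-inv (X⊆G Xg)) ς ς (sign-⁻¹ {g} (X⊆G Xg) ς (X-sign Xg) _) (X-sign Xh x))
          -- The quotient of `h` by `g` is even at `x` and fixes `x`, hence also `x₀` in the same
          -- block.
          gx₀≡hx₀ : app g x₀ ≡ app h x₀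
          gx₀≡hx₀ = trans (cong (app g) (sym (fixes-block {(g ⁻¹) · h} even
              (trans (cong (app (g ⁻¹)) (sym gx≡hx)) (⁻¹-cancelˡ g x)) x₀~x
              (G-mul (G-inv (X⊆G Xg)) (X⊆G Xh)))))
            (⁻¹-cancelʳ g _)

      -- As `X` meets at least two cosets of `K`, each of its elements has a partner in another
      -- coset, and `cover-label` yields one translate per label.
      cover-labels : ¬ (∀ g h → X g → X h → g ∼ h) → Cover d X
      cover-labels ¬same = (λ j → proj₁ (pick j)) , (λ j → proj₁ (proj₂ (pick j))) , cov
        where
        other : ∀ g → X g → ∃ λ h → X h × ¬ (g ∼ h)
        other g Xg = by-contradiction λ none → ¬same λ h h′ Xh Xh′ x →
          let near : ∀ {h} → X h → g ∼ h
              near Xh = by-contradiction λ g≁h → none (_ , Xh , g≁h)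
          in trans (sym (near Xh x)) (near Xh′ x)
        pick : ∀ j → ∃ λ σ → ∃ λ π → ∀ g → X g → Label g j → Cω ((σ · g) · π)
        pick j with lem (∃ λ g → X g × Label g j)
        ... | no ¬∃ = e , e , λ g Xg l → contradiction (g , Xg , l) ¬∃
        ... | yes (g₀ , Xg₀ , l₀) = let h , Xh , g₀≁h = other g₀ Xg₀ in
                cover-label {g₀} {h} j Xg₀ Xh l₀ g₀≁h
        cov : ∀ g → X g → ∃ λ j → Cω ((proj₁ (pick j) · g) · proj₁ (proj₂ (pick j)))
        cov g Xg = let s , j , g∼ = normal-form {g} (X⊆G Xg) in j , proj₂ (proj₂ (pick j)) g Xg (s , g∼)

      cover-class : Cover (d ⊔ 3) X
      cover-class with lem (∀ g h → X g → X h → g ∼ h)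
      ... | yes same = cover-≤ (ℕ.m≤n⊔m d 3) (cover-coset same)
      ... | no ¬same = cover-≤ (ℕ.m≤m⊔n d 3) (cover-labels ¬same)

    -- The bound and the families attaining it

    length-L′ : length L ≡ d * (2 * n)
    length-L′ = ℕ.*-cancelˡ-≡ _ _ 3 (trans length-L
      (solve 2 (λ d n → d :* (con 2 :* (con 3 :* n)) := con 3 :* (d :* (con 2 :* n))) refl d n))

    -- The two sign classes exhaust `F`, and each needs at most `d ⊔ 3` translates of `Cω`.
    upper-bound : ∀ F → IntersectingFamily G F → length F * d ≤ (d ⊔ 3) * length L
    upper-bound F (F⊆G , distinct , meet) = begin
      length F * d                        ≤⟨ ℕ.*-monoˡ-≤ d bound ⟩
      (((d ⊔ 3) + (d ⊔ 3)) * n) * d       ≡⟨ solve 3 (λ D d n → ((D :+ D) :* n) :* d := D :* (d :* (con 2 :* n)))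
                                               refl (d ⊔ 3) d n ⟩
      (d ⊔ 3) * (d * (2 * n))             ≡⟨ cong ((d ⊔ 3) *_) length-L′ ⟨
      (d ⊔ 3) * length L                  ∎
      where
      open ℕ.≤-Reasoning
      X : Bool → Perm (3 * p) → Set
      X ς g = g ∈ F × Sign g ς
      class : ∀ ς → Cover (d ⊔ 3) (X ς)
      class ς = cover-class (X ς) (λ (g∈ , _) → All.lookup F⊆G g∈)
        (λ {g} {h} (g∈ , _) (h∈ , _) → intersect (∈-AllPairs₂ meet g∈ h∈)) ς proj₂
        where
        intersect : ∀ {g h : Perm (3 * p)} → g ≡ h ⊎ (∃ λ x → app g x ≡ app h x) ⊎ (∃ λ x → app h x ≡ app g x) →
                    ∃ λ x → app g x ≡ app h x
        intersect (inj₁ refl)            = ω , refl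
        intersect (inj₂ (inj₁ meet))     = meet
        intersect (inj₂ (inj₂ (x , eq))) = x , sym eq
      cover : Cover ((d ⊔ 3) + (d ⊔ 3)) (λ g → X false g ⊎ X true g)
      cover = cover-∪ (class false) (class true)
      covered : ∀ i → X false (lookup F i) ⊎ X true (lookup F i)
      covered i with G-sign (All.lookup F⊆G (∈-lookup {xs = F} i))
      ... | false , s = inj₁ (∈-lookup i , s)
      ... | true  , s = inj₂ (∈-lookup i , s)
      bound : length F ≤ ((d ⊔ 3) + (d ⊔ 3)) * n
      bound = card-bound card-Cω (lookup F) (distinct⇒lookup-injective distinct)
        (proj₁ cover) (proj₁ (proj₂ cover)) (λ i → proj₂ (proj₂ cover) _ (covered i))

    -- The family is `L` itself when `3 ≤ d`, and `K` when `d ≤ 3`. Two elements of `K` agree where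
    -- their quotient has its fixed point.
    attained : ∃ λ F → IntersectingFamily G F × length F * d ≡ (d ⊔ 3) * length L
    attained with ℕ.≤-total 3 d
    ... | inj₁ 3≤d = L , (All.map proj₁ (proj₁ L-enumerates) , proj₁ (proj₂ L-enumerates) , meet (proj₁ L-enumerates))
          , trans (ℕ.*-comm (length L) d) (cong (_* length L) (sym (ℕ.m≥n⇒m⊔n≡m 3≤d)))
      where
      meet : ∀ {xs} → All (λ g → G g × app g ω ≡ ω) xs → AllPairs (λ g h → ∃ λ x → app g x ≡ app h x) xs
      meet []               = []
      meet ((_ , gω) ∷ pxs) = All.map (λ (_ , hω) → ω , trans gω (sym hω)) pxs ∷ meet pxs
    ... | inj₂ d≤3 = tabulate at
          , (All.tabulate⁺ (λ i → proj₁ (sound i))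
            , AllPairs.tabulate⁺ (λ i≢j eq → i≢j (injective _ _ eq))
            , AllPairs.tabulate⁺ (λ {i} {j} _ → meet (at i) (at j) (sound i) (sound j)))
          , (begin
              length (tabulate at) * d      ≡⟨ cong (_* d) (length-tabulate at) ⟩
              (2 * (3 * n)) * d             ≡⟨ ℕ.*-comm _ d ⟩
              d * (2 * (3 * n))             ≡⟨ length-L ⟨
              3 * length L                  ≡⟨ cong (_* length L) (ℕ.m≤n⇒m⊔n≡n d≤3) ⟨
              (d ⊔ 3) * length L            ∎)
      where
      open ≡-Reasoning
      open Card card-K′
      meet : ∀ g h → K g → K h → ∃ λ x → app g x ≡ app h x
      meet g h Kg Kh with K-fixes-point ((g ⁻¹) · h) (K-· {g ⁻¹} {h} (K-⁻¹ {g} Kg) Kh)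
      ... | x , fix = x , trans (cong (app g) (sym fix)) (⁻¹-cancelʳ g _)

-- The ratio is cleared of denominators: max(1, 3/d) is `d ⊔ 3` over `d`, and `length L` is the
-- order of the stabiliser of `ω`. The group generated by `K`, `a` and `b` is all of `G`, so the
-- results for `G` carry over.
theorem8p3 : (p : ℕ) → Prime p → 5 ≤ p →
    (G : Perm (3 * p) → Set) → IsSubgroup G → Transitive G →
    (blk : Fin (3 * p) → Fin p) → BlocksOfSize3 blk →
    UniqueNontrivialBlockSystem blk G →
    Nontrivial (Kernel blk G) →
    (∀ k → Kernel blk G k → ∃ λ x → app k x ≡ x) →
    (∀ (N : Perm (3 * p) → Set) → MinimalNormal G N → (∀ g → N g → Kernel blk G g)
    → ElementaryAbelian3 N) →
    (∃ λ k → Kernel blk G k × ¬ (k ≈ e) × ((k · k) ≈ e)) →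
    (a : Perm (3 * p)) → G a → pow a p ≈ e →
    (∀ k x → 0 < k → k < p → app (pow a k) x ≢ x) →
    (∀ k i → 0 < k → k < p → ¬ FixesBlock blk (pow a k) i) →
    (b : Perm (3 * p)) → G b → (d : ℕ) → 0 < d → d ∣ (p ∸ 1) →
    SameOnBlocks blk (pow b d) e →
    (∀ k → 0 < k → k < d → ¬ SameOnBlocks blk (pow b k) e) →
    (∃ λ i → FixesBlock blk b i) →
    (∃ λ t → gcd t p ≡ 1 × SameOnBlocks blk ((b · a) · (b ⁻¹)) (pow a t)) →
    (∀ g → G g → ∃ λ h → Gen (λ x → (x ≈ a) ⊎ (x ≈ b)) h × SameOnBlocks blk g h) →
    let H = Gen (λ g → Kernel blk G g ⊎ (g ≈ a) ⊎ (g ≈ b)) in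
    (ω : Fin (3 * p)) (L : List (Perm (3 * p))) → EnumeratesStabiliser H ω L →
    ((F : List (Perm (3 * p))) → IntersectingFamily H F →
    length F * d ≤ (d ⊔ 3) * length L)
    × (∃ λ F → IntersectingFamily H F × length F * d ≡ (d ⊔ 3) * length L)
theorem8p3 p p-prime 5≤p G G-sub G-trans blk blocks₃ unique-blocks K-nontrivial K-fixes-point _ involution
    a Ga aᵖ≈e _ a-blocks b Gb d 0<d _ bᵈ∈K b-order (i₀ , b-fixes) (t , _ , ba∼aᵗb) generated ω L L-enumerates =
    (λ F (F⊆H , rest) → upper-bound F (All.map H⊆G F⊆H , rest))
  , (let F , (F⊆G , rest) , size = attained in F , (All.map G⊆H F⊆G , rest) , size)
  where
  open Setting p p-prime 5≤p G G-sub G-trans blk blocks₃ unique-blocks K-nontrivial K-fixes-point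
    a Ga aᵖ≈e a-blocks b Gb d 0<d bᵈ∈K b-order i₀ b-fixes t ba∼aᵗb generated
  H : Perm (3 * p) → Set
  H = Gen (λ g → Kernel blk G g ⊎ (g ≈ a) ⊎ (g ≈ b))
  H⊆G : ∀ {g} → H g → G g
  H⊆G (gen (inj₁ (Gg , _)))      = Gg
  H⊆G (gen (inj₂ (inj₁ g≈a)))    = IsSubgroup.resp G-sub (sym ∘ g≈a) Ga
  H⊆G (gen (inj₂ (inj₂ g≈b)))    = IsSubgroup.resp G-sub (sym ∘ g≈b) Gb
  H⊆G one                        = IsSubgroup.has-e G-sub
  H⊆G (mul g∈ h∈)                = IsSubgroup.mul G-sub (H⊆G g∈) (H⊆G h∈)
  H⊆G (inv g∈)                   = IsSubgroup.inv G-sub (H⊆G g∈)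
  H⊆G (resp g≈h g∈)              = IsSubgroup.resp G-sub g≈h (H⊆G g∈)
  ⟨a,b⟩⊆H : ∀ {g} → Gen (λ x → (x ≈ a) ⊎ (x ≈ b)) g → H g
  ⟨a,b⟩⊆H (gen s)       = gen (inj₂ s)
  ⟨a,b⟩⊆H one           = one
  ⟨a,b⟩⊆H (mul g∈ h∈)   = mul (⟨a,b⟩⊆H g∈) (⟨a,b⟩⊆H h∈)
  ⟨a,b⟩⊆H (inv g∈)      = inv (⟨a,b⟩⊆H g∈)
  ⟨a,b⟩⊆H (resp g≈h g∈) = resp g≈h (⟨a,b⟩⊆H g∈)
  G⊆H : ∀ {g} → G g → H g
  G⊆H {g} Gg with generated g Gg
  -- Since `h` and `g` act alike on the blocks, `g` is `h` times an element of `K`.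
  ... | h , h∈ , g∼h = resp (λ x → ⁻¹-cancelʳ h (app g x))
          (mul (⟨a,b⟩⊆H h∈) (gen (inj₁ (K-quotient {h} {g} (H⊆G (⟨a,b⟩⊆H h∈)) Gg (λ x → sym (g∼h x))))))
  open Stabiliser (involution⇒odd involution) ω L
    ( All.map (λ (g∈ , gω) → H⊆G g∈ , gω) (proj₁ L-enumerates)
    , proj₁ (proj₂ L-enumerates)
    , λ g Gg → proj₂ (proj₂ L-enumerates) g (G⊆H Gg))
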